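{- Let $y>3$ be an integer, let $a,b,c\ge0$ be integers, and let $L=\{1^a,3^b,y^c\}$ be an admissible multiset of size $v-1$ (so $v=a+b+c+1$). Write $v=3q+r$ with $0\le r<3$. Then $L$ has a linear realization in each of the following cases: (1) $a\ge y+1$; (2) $a\ge7$ and $b\ge y-4$; (3) $a\ge4$, $a+b\ge y+1$, and $c\equiv0$ or $1\pmod y$; (4) $a\ge2$, $y=3t$ for an integer $t$, $v\ge3t+6$, and either $r$ is even and $b\ge3t$, or $r$ is odd and $b\ge3t+1$.
   Context: $K_v$ is the complete graph on vertex set $\{0,\dots,v-1\}$; the linear length of an edge $\{u,w\}$ is $|u-w|$. A multiset of size $v-1$ has a linear realization if some Hamiltonian path in $K_v$ has multiset of linear edge lengths equal to it. $\{x_1^{a_1},\dots\}$ denotes the multiset with $x_i$ of multiplicity $a_i$; $\mathrm{supp}(L)$ is the set of distinct elements. A multiset $L$ of size $v-1$ is admissible if $\mathrm{supp}(L)\subseteq\{1,\dots,\lfloor v/2\rfloor\}$ and for every divisor $d$ of $v$ the number of elements of $L$ (counted with multiplicity) divisible by $d$ is at most $v-d$. -}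

module Defs where

open import Data.Nat using (ℕ; zero; suc; _+_; _*_; _∸_; _≤_; _<_; _/_; ∣_-_∣)
open import Data.Nat.Divisibility using (_∣_; _∣?_)
open import Data.List using (List; []; _∷_; length; upTo; filter; replicate; _++_)
open import Data.List.Relation.Unary.All using (All)
open import Data.List.Relation.Binary.Permutation.Propositional using (_↭_)
open import Data.Product using (Σ; _×_)
open import Relation.Binary.PropositionalEquality using (_≡_)

edgeLengths : List ℕ → List ℕ
edgeLengths []            = []
edgeLengths (x ∷ [])      = []
edgeLengths (x ∷ y ∷ xs)  = ∣ x - y ∣ ∷ edgeLengths (y ∷ xs)

-- A Hamiltonian path in K_v: a list visiting each vertex of {0,…,v-1}
-- exactly once, i.e. a permutation of [0,…,v-1].
IsHamPath : ℕ → List ℕ → Set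
IsHamPath v p = p ↭ upTo v

-- Multisets are lists up to permutation.
-- L (of size v-1) has a linear realization in K_v.
HasLinearRealization : ℕ → List ℕ → Set
HasLinearRealization v L = Σ (List ℕ) (λ p → IsHamPath v p × (edgeLengths p ↭ L))

countDiv : ℕ → List ℕ → ℕ
countDiv d L = length (filter (d ∣?_) L)

Admissible : ℕ → List ℕ → Set
Admissible v L =
  (length L ≡ v ∸ 1) ×
  All (λ x → 1 ≤ x × x ≤ v / 2) L ×
  ((d : ℕ) → d ∣ v → countDiv d L ≤ v ∸ d)

L13y : ℕ → ℕ → ℕ → ℕ → List ℕ
L13y a b c y = replicate a 1 ++ replicate b 3 ++ replicate c y

{-# OPTIONS --safe #-}
module Submission where

-- Arrange the vertices in y columns x, y + x, y + 2x, …  A path that visits the columns one after the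
-- other, alternately upwards and downwards, uses the length y everywhere except between columns, where
-- the order of the columns (a path with steps 1 and 3 on 0, …, y - 1) determines the lengths.  Such a
-- path grows by one vertex per column, so c is reduced mod y; the columns of unequal height that then
-- remain force the parity conditions, which are met by moving to the left or to the right from column 0
-- or by one turn between the last two columns.  The paths start at 0, and are preceded by a path with
-- steps 1 and 3 that ends at its largest vertex.  The column orders are obtained by the same growth with
-- 3 in place of y.  In case (4), where 3 divides y = 3t, the three residue classes mod 3 are joined by
-- two steps of length 1 and on each class the path is one for the lengths 1 and t, scaled by 3.

open import Defs
open import Data.Nat using (ℕ; zero; suc; _+_; _*_; _≤_; _<_; _%_; _/_; ∣_-_∣; z≤n; s≤s; _<?_; _≤?_)
open import Data.Nat.DivMod using (m≡m%n+[m/n]*n; m%n<n; [m+kn]%n≡m%n)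
open import Data.Nat.Properties
open import Data.Nat.Tactic.RingSolver using (solve-∀)
open import Data.Empty using (⊥; ⊥-elim)
open import Data.List using (List; []; _∷_; _++_; map; length; filter; replicate; upTo; applyUpTo)
open import Data.List.Properties
  using (++-assoc; ++-identityʳ; map-++; length-++; filter-++; filter-all; filter-none; filter-accept; filter-reject)
open import Data.List.Relation.Binary.Permutation.Propositional hiding (trans)
open import Data.List.Relation.Binary.Permutation.Propositional.Properties
  using (++⁺; ++⁺ˡ; ++⁺ʳ; ++-comm; shift; shifts; map⁺; filter-↭; All-resp-↭; ↭-length; ++-commutativeMonoid)
open import Data.List.Relation.Unary.All as All using (All; []; _∷_)
open import Data.List.Relation.Unary.All.Properties using (++⁻ˡ; ++⁻ʳ)
open import Data.List.Sort.Base ≤-totalOrder using (module SortingAlgorithm)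
open import Data.List.Sort.InsertionSort ≤-decTotalOrder using (insertionSort)
open import Data.Product using (Σ; ∃-syntax; _×_; _,_; proj₁; proj₂)
open import Data.Sum using (_⊎_; inj₁; inj₂; [_,_]′)
open import Algebra.Solver.CommutativeMonoid (++-commutativeMonoid {A = ℕ}) using (solve; _⊕_; _⊜_)
open import Relation.Binary.PropositionalEquality using (_≡_; refl; sym; trans; cong; cong₂; subst; subst₂)
open import Relation.Nullary using (yes; no)

open SortingAlgorithm insertionSort using (sort; sort-↭)

-- Intervals of vertices

range : ℕ → ℕ → List ℕ
range k zero    = []
range k (suc n) = k ∷ range (suc k) n

countdown : ℕ → ℕ → List ℕ
countdown k zero    = []
countdown k (suc n) = n + k ∷ countdown k n

range-+ : ∀ k m n → range k (m + n) ≡ range k m ++ range (m + k) n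
range-+ k zero    n = refl
range-+ k (suc m) n =
  cong (k ∷_) (trans (range-+ (suc k) m n) (cong (λ i → range (suc k) m ++ range i n) (+-suc m k)))

length-range : ∀ k n → length (range k n) ≡ n
length-range k zero    = refl
length-range k (suc n) = cong suc (length-range (suc k) n)

map-range : ∀ m k n → map (m +_) (range k n) ≡ range (m + k) n
map-range m k zero    = refl
map-range m k (suc n) =
  cong (m + k ∷_) (trans (map-range m (suc k) n) (cong (λ i → range i n) (+-suc m k)))

countdown-↭ : ∀ k n → countdown k n ↭ range k n
countdown-↭ k zero    = refl
countdown-↭ k (suc n) =
  ↭-trans (prep (n + k) (countdown-↭ k n))
  (↭-trans (++-comm (n + k ∷ []) (range k n))
  (↭-reflexive (trans (sym (range-+ k n 1)) (cong (range k) (+-comm n 1)))))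

applyUpTo-range : ∀ f k n → (∀ i → f i ≡ k + i) → applyUpTo f n ≡ range k n
applyUpTo-range f k zero    eq = refl
applyUpTo-range f k (suc n) eq =
  cong₂ _∷_ (trans (eq 0) (+-identityʳ k)) (applyUpTo-range _ (suc k) n λ i → trans (eq (suc i)) (+-suc k i))

upTo-range : ∀ n → upTo n ≡ range 0 n
upTo-range n = applyUpTo-range _ 0 n λ _ → refl

range-≥ : ∀ k n → All (k ≤_) (range k n)
range-≥ k zero    = []
range-≥ k (suc n) = ≤-refl ∷ All.map <⇒≤ (range-≥ (suc k) n)

range-< : ∀ k n {y} → k + n ≤ y → All (_< y) (range k n)
range-< k zero    le = []
range-< k (suc n) le =
  ≤-trans (s≤s (m≤m+n k n)) k+n<y ∷ range-< (suc k) n k+n<y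
  where k+n<y = ≤-trans (≤-reflexive (sym (+-suc k n))) le

↭-range-< : ∀ {p k n y} → p ↭ range k n → k + n ≤ y → All (_< y) p
↭-range-< {k = k} {n} cover le = All-resp-↭ (↭-sym cover) (range-< k n le)

↭-range-length : ∀ {p k n} → p ↭ range k n → length p ≡ n
↭-range-length {k = k} {n} cover = trans (↭-length cover) (length-range k n)

-- Walks

-- The lengths 1 and 3 are counted by a and b; since the number of steps of a walk is known from
-- the number of vertices it visits, the multiplicity of y need not be recorded.
data Step (y l : ℕ) : ℕ → ℕ → Set where
  one   : l ≡ 1 → Step y l 1 0
  three : l ≡ 3 → Step y l 0 1
  big   : l ≡ y → Step y l 0 0

-- Walk y x p e a b : the walk x ∷ p ends in e.  As x is not listed in p, walks that share an
-- endpoint compose by concatenation.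
data Walk (y : ℕ) : ℕ → List ℕ → ℕ → ℕ → ℕ → Set where
  stop : ∀ {x} → Walk y x [] x 0 0
  step : ∀ {x z p e i j a b} → Step y ∣ x - z ∣ i j → Walk y z p e a b → Walk y x (z ∷ p) e (i + a) (j + b)

recount : ∀ {y x p e a b a′ b′} → a ≡ a′ → b ≡ b′ → Walk y x p e a b → Walk y x p e a′ b′
recount refl refl w = w

infixr 5 _▷_
_▷_ : ∀ {y x p z q e a b a′ b′} →
  Walk y x p z a b → Walk y z q e a′ b′ → Walk y x (p ++ q) e (a + a′) (b + b′)
stop ▷ v = v
step {i = i} {j} {a} {b} s w ▷ v = recount (sym (+-assoc i a _)) (sym (+-assoc j b _)) (step s (w ▷ v))

single : ∀ {y x z i j} → Step y ∣ x - z ∣ i j → Walk y x (z ∷ []) z i j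
single s = recount (+-identityʳ _) (+-identityʳ _) (step s stop)

relength : ∀ {y l l′ i j} → l ≡ l′ → Step y l i j → Step y l′ i j
relength refl s = s

distance : ∀ {m n} d → n ≡ d + m → ∣ m - n ∣ ≡ d
distance {m} d refl = trans (cong (λ i → ∣ m - i ∣) (+-comm d m)) (∣m-m+n∣≡n m d)

distance′ : ∀ {m n} d → n ≡ d + m → ∣ n - m ∣ ≡ d
distance′ {m} {n} d eq = trans (∣-∣-comm n m) (distance d eq)

translate : ∀ {y x p e a b} k → Walk y x p e a b → Walk y (k + x) (map (k +_) p) (k + e) a b
translate k stop       = stop
translate k (step s w) = step (relength (sym (∣m+n-m+o∣≡∣n-o∣ k _ _)) s) (translate k w)

reverseWalk : ∀ {y x p e a b} → Walk y x p e a b → ∃[ q ] (Walk y e q x a b × e ∷ q ↭ x ∷ p)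
reverseWalk stop = [] , stop , refl
reverseWalk (step {x} {z} {p} {e} {i} {j} {a} {b} s w) with q , w′ , cover ← reverseWalk w =
  q ++ x ∷ [] ,
  recount (+-comm a i) (+-comm b j) (w′ ▷ single (relength (∣-∣-comm x z) s)) ,
  ↭-trans (++⁺ʳ (x ∷ []) cover) (++-comm (z ∷ p) (x ∷ []))

edgeLengths-↭ : ∀ {y x p e a b} → Walk y x p e a b →
  ∃[ c ] (edgeLengths (x ∷ p) ↭ L13y a b c y × length p ≡ a + b + c)
edgeLengths-↭ stop = 0 , refl , refl
edgeLengths-↭ (step s w) with edgeLengths-↭ w
edgeLengths-↭ (step (one eq) w) | c , lengths , len =
  c , ↭-trans (↭-reflexive (cong (_∷ _) eq)) (prep 1 lengths) , cong suc len
edgeLengths-↭ {y = y} (step {a = a} {b} (three eq) w) | c , lengths , len =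
  c ,
  ↭-trans (↭-reflexive (cong (_∷ _) eq))
    (↭-trans (prep 3 lengths) (↭-sym (shift 3 (replicate a 1) (replicate b 3 ++ replicate c y)))) ,
  trans (cong suc len) (cong (_+ c) (sym (+-suc a b)))
edgeLengths-↭ {y = y} (step {a = a} {b} (big eq) w) | c , lengths , len =
  suc c ,
  ↭-trans (↭-reflexive (cong (_∷ _) eq))
    (↭-trans (prep y lengths)
    (↭-trans (↭-sym (shift y (replicate a 1) (replicate b 3 ++ replicate c y)))
    (++⁺ˡ (replicate a 1) (↭-sym (shift y (replicate b 3) (replicate c y)))))) ,
  trans (cong suc len) (sym (+-suc (a + b) c))

realize : ∀ {y x p e} a b c → Walk y x p e a b → x ∷ p ↭ range 0 (a + b + c + 1) →
  HasLinearRealization (a + b + c + 1) (L13y a b c y)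
realize {y} {x} {p} a b c w cover with c′ , lengths , len ← edgeLengths-↭ w =
  x ∷ p ,
  ↭-trans cover (↭-reflexive (sym (upTo-range (a + b + c + 1)))) ,
  subst (λ i → edgeLengths (x ∷ p) ↭ L13y a b i y) c′≡c lengths
  where
  c′≡c : c′ ≡ c
  c′≡c = +-cancelˡ-≡ (a + b) _ _
    (suc-injective (trans (cong suc (sym len)) (trans (↭-range-length cover) (+-comm (a + b + c) 1))))

-- Growing a path

data Side : Set where
  below above : Side

opposite : Side → Side
opposite below = above
opposite above = below

-- Parity: n is even if flips s n ≡ s and odd if flips s n ≡ opposite s.
flips : Side → ℕ → Side
flips s zero    = s
flips s (suc n) = flips (opposite s) n

flips-+ : ∀ s m n → flips s (m + n) ≡ flips (flips s m) n
flips-+ s zero    n = refl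
flips-+ s (suc m) n = flips-+ (opposite s) m n

flips-opposite : ∀ s n → flips (opposite s) n ≡ opposite (flips s n)
flips-opposite s     (suc n) = flips-opposite (opposite s) n
flips-opposite below zero    = refl
flips-opposite above zero    = refl

lift : ℕ → Side → ℕ → ℕ
lift y below x = x
lift y above x = y + x

-- Inserting y vertices between the vertices < y and the others keeps all edge lengths of a path,
-- up to new edges of length y, provided that the path passes from one part to the other exactly
-- at the vertices x < y: these are replaced by the edge from x to y + x, traversed upwards or
-- downwards.  Run y s p s′ says that p is such a path, s and s′ being the sides of its ends.
data Run (y : ℕ) : Side → List ℕ → Side → Set where
  []   : ∀ {s} → Run y s [] s
  up   : ∀ {x p s} → x < y → Run y above p s → Run y below (x ∷ p) s
  down : ∀ {x p s} → x < y → Run y below p s → Run y above (x ∷ p) s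
  high : ∀ {z x p s} → z ≡ y + x → Run y above p s → Run y above (z ∷ p) s

grow : ∀ {y s p s′} → Run y s p s′ → List ℕ
grow []               = []
grow {y} (up {x} _ r)   = x ∷ y + x ∷ grow r
grow {y} (down {x} _ r) = y + x ∷ x ∷ grow r
grow {y} (high {z} _ r) = y + z ∷ grow r

infixr 5 _⋈_
_⋈_ : ∀ {y s p s′ q s″} → Run y s p s′ → Run y s′ q s″ → Run y s (p ++ q) s″
[]         ⋈ r′ = r′
up lt r    ⋈ r′ = up lt (r ⋈ r′)
down lt r  ⋈ r′ = down lt (r ⋈ r′)
high eq r  ⋈ r′ = high eq (r ⋈ r′)

-- A crossing at `x` becomes the edge between `x` and `y + x`, which again crosses at `x` only, so
-- growth can be iterated.
grow-run : ∀ {y s p s′} (r : Run y s p s′) → Run y s (grow r) s′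
grow-run []          = []
grow-run (up lt r)   = up lt (high refl (grow-run r))
grow-run (down lt r) = high refl (down lt (grow-run r))
grow-run (high eq r) = high refl (grow-run r)

-- Among vertices `< y` each one is a crossing, so any order of them is a run and its final side
-- depends only on their number.
alternating : ∀ {y p} s → All (_< y) p → Run y s p (flips s (length p))
alternating s     []         = []
alternating below (lt ∷ lts) = up lt (alternating above lts)
alternating above (lt ∷ lts) = down lt (alternating below lts)

alternating-range : ∀ {y p k n s′} s → p ↭ range k n → k + n ≤ y → flips s n ≡ s′ → Run y s p s′
alternating-range s cover le refl =
  subst (λ i → Run _ s _ (flips s i)) (↭-range-length cover) (alternating s (↭-range-< cover le))

-- Between two crossings both ends of a step are fixed or both are shifted by `y`; only the edges
-- inserted at crossings are new.
grow-walk : ∀ {y s p s′ x e a b} (r : Run y s p s′) → Walk y x p e a b →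
  Walk y (lift y s x) (grow r) (lift y s′ e) a b
grow-walk []         stop       = stop
grow-walk {y} (up {x} _ r) (step s w) = step s (step (big (distance {x} y refl)) (grow-walk r w))
grow-walk {y} (down {x} _ r) (step s w) =
  step (relength (sym (∣m+n-m+o∣≡∣n-o∣ y _ _)) s) (step (big (distance′ {x} y refl)) (grow-walk r w))
grow-walk {y} (high _ r) (step s w) = step (relength (sym (∣m+n-m+o∣≡∣n-o∣ y _ _)) s) (grow-walk r w)

grow-head : ∀ {y s x p s′ e a b} (r : Run y s (x ∷ p) s′) → Walk y x p e a b →
  ∃[ q ] (grow r ≡ lift y s x ∷ q × Walk y (lift y s x) q (lift y s′ e) a b)
grow-head {y} (up {x} _ r)   w = y + x ∷ grow r , refl , step (big (distance {x} y refl)) (grow-walk r w)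
grow-head {y} (down {x} _ r) w = x ∷ grow r , refl , step (big (distance′ {x} y refl)) (grow-walk r w)
grow-head     (high _ r)     w = grow r , refl , grow-walk r w

grow-↭ : ∀ {y s p s′} (r : Run y s p s′) → grow r ↭ filter (_<? y) p ++ map (y +_) p
grow-↭ [] = refl
grow-↭ {y} (up {x} {p} lt r) =
  ↭-trans (prep x (↭-trans (prep (y + x) (grow-↭ r)) (↭-sym (shift (y + x) (filter (_<? y) p) (map (y +_) p)))))
  (↭-reflexive (cong (_++ map (y +_) (x ∷ p)) (sym (filter-accept (_<? y) lt))))
grow-↭ {y} (down {x} {p} lt r) =
  ↭-trans (swap (y + x) x refl)
  (↭-trans (prep x (↭-trans (prep (y + x) (grow-↭ r)) (↭-sym (shift (y + x) (filter (_<? y) p) (map (y +_) p)))))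
  (↭-reflexive (cong (_++ map (y +_) (x ∷ p)) (sym (filter-accept (_<? y) lt)))))
grow-↭ {y} (high {z} {x} {p} refl r) =
  ↭-trans (↭-trans (prep (y + z) (grow-↭ r)) (↭-sym (shift (y + z) (filter (_<? y) p) (map (y +_) p))))
  (↭-reflexive (cong (_++ map (y +_) (z ∷ p)) (sym (filter-reject (_<? y) (m+n≮m y x)))))

grow-↭-small : ∀ {y s p s′} (r : Run y s p s′) → All (_< y) p → grow r ↭ p ++ map (y +_) p
grow-↭-small {y} {p = p} r small =
  ↭-trans (grow-↭ r) (↭-reflexive (cong (_++ map (y +_) p) (filter-all (_<? y) small)))

record Grid (y s : ℕ) (σ : Side) (e : ℕ) (τ : Side) (a b w : ℕ) : Set where
  constructor grid
  field
    {path} : List ℕ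
    walk   : Walk y s path e a b
    run    : Run y σ (s ∷ path) τ
    cover  : s ∷ path ↭ range 0 w

filter-range : ∀ y j → filter (_<? y) (range 0 (y + j)) ≡ range 0 y
filter-range y j =
  trans (cong (filter (_<? y)) (range-+ 0 y j))
  (trans (filter-++ (_<? y) (range 0 y) (range (y + 0) j))
  (trans (cong₂ _++_ (filter-all (_<? y) (range-< 0 y ≤-refl))
                     (filter-none (_<? y) (All.map (λ le → ≤⇒≯ (≤-trans (m≤m+n y 0) le)) (range-≥ (y + 0) j))))
  (++-identityʳ _)))

-- As `y ≤ w`, the crossings are all of `0, …, y - 1`. They stay, and the `w` vertices shifted by
-- `y` fill up the rest.
growGrid : ∀ {y s σ e τ a b w} → y ≤ w → Grid y s σ e τ a b w → Grid y (lift y σ s) σ (lift y τ e) τ a b (y + w)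
growGrid {y} {s} {σ} {w = w} y≤w (grid {p} wk r cover) with q , eq , wk′ ← grow-head r wk =
  grid wk′ (subst (λ l → Run y σ l _) eq (grow-run r))
  (↭-trans (↭-reflexive (sym eq))
  (↭-trans (grow-↭ r)
  (↭-trans (++⁺ (filter-↭ (_<? y) cover) (map⁺ (y +_) cover))
  (↭-reflexive (trans (cong₂ _++_ small (map-range y 0 w)) (sym (range-+ 0 y w)))))))
  where
  small : filter (_<? y) (range 0 w) ≡ range 0 y
  small = subst (λ i → filter (_<? y) (range 0 i) ≡ range 0 y) (m+[n∸m]≡n y≤w) (filter-range y _)

raise : ℕ → Side → ℕ → ℕ → ℕ
raise y s zero    x = x
raise y s (suc k) x = lift y s (raise y s k x)

growGrids : ∀ {y s σ e τ a b w} k → y ≤ w → Grid y s σ e τ a b w →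
  Grid y (raise y σ k s) σ (raise y τ k e) τ a b (raise y above k w)
growGrids zero    y≤w g = g
growGrids (suc k) y≤w g = growGrid (≤-trans y≤w (w≤ k)) (growGrids k y≤w g)
  where
  w≤ : ∀ {y w} k → w ≤ raise y above k w
  w≤ zero    = ≤-refl
  w≤ (suc k) = ≤-trans (w≤ k) (m≤n+m _ _)

-- Orders of the columns

straight : ∀ y e n → Walk y e (range (suc e) n) (n + e) n 0
straight y e zero    = stop
straight y e (suc n) =
  step (one (distance {e} 1 refl))
    (subst (λ i → Walk y (suc e) (range (suc (suc e)) n) i n 0) (+-suc n e) (straight y (suc e) n))

straightDown : ∀ y k n → Walk y (n + k) (countdown k n) k n 0
straightDown y k zero    = stop
straightDown y k (suc n) = step (one (distance′ {n + k} 1 refl)) (straightDown y k n)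

-- In a walk for `3` all lengths are 1 or 3, so whatever is not a one is a three, for any `y`.
countThrees : ∀ {x p e a b} y → Walk 3 x p e a b → ∃[ b′ ] (Walk y x p e a b′ × a + b′ ≡ length p)
countThrees y stop = 0 , stop , refl
countThrees y (step (one eq) w) with b , w′ , len ← countThrees y w =
  b , step (one eq) w′ , cong suc len
countThrees y (step {a = a} (three eq) w) with b , w′ , len ← countThrees y w =
  suc b , step (three eq) w′ , trans (+-suc a b) (cong suc len)
countThrees y (step {a = a} (big eq) w) with b , w′ , len ← countThrees y w =
  suc b , step (three eq) w′ , trans (+-suc a b) (cong suc len)

-- e ↗ k: the block of vertices k, k + 1, … can be entered from e at k by a step of length 1 or 3;
-- likewise e ↘ k for the block …, k - 2, k - 1.
infix 4 _↗_ _↘_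
_↗_ _↘_ : ℕ → ℕ → Set
e ↗ k = k ≡ 1 + e ⊎ k ≡ 3 + e
e ↘ k = e ≡ k ⊎ e ≡ 2 + k

↗-+ : ∀ k {e n} → e ↗ n → k + e ↗ n + k
↗-+ k {e} (inj₁ eq) = inj₁ (trans (cong (_+ k) eq) (cong (1 +_) (+-comm e k)))
↗-+ k {e} (inj₂ eq) = inj₂ (trans (cong (_+ k) eq) (cong (3 +_) (+-comm e k)))

↘-+ : ∀ k {e} → e ↘ 0 → k + e ↘ k
↘-+ k (inj₁ refl) = inj₁ (+-identityʳ k)
↘-+ k (inj₂ refl) = inj₂ (+-comm k 2)

enter↗ : ∀ {e k} y → e ↗ k → ∃[ i ] ∃[ j ] (Step y ∣ e - k ∣ i j × i + j ≡ 1 × i ≤ 1)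
enter↗ y (inj₁ eq) = 1 , 0 , one (distance 1 eq) , refl , ≤-refl
enter↗ y (inj₂ eq) = 0 , 1 , three (distance 3 eq) , refl , z≤n

enter↘ : ∀ {e k} y → e ↘ suc k → ∃[ i ] ∃[ j ] (Step y ∣ e - k ∣ i j × i + j ≡ 1 × i ≤ 1)
enter↘ y (inj₁ eq) = 1 , 0 , one (distance′ 1 eq) , refl , ≤-refl
enter↘ y (inj₂ eq) = 0 , 1 , three (distance′ 3 eq) , refl , z≤n

sorted : ∀ p → p ↭ sort p
sorted p = ↭-sym (sort-↭ p)

pattern 0<3 = s≤s z≤n
pattern 1<3 = s≤s (s≤s z≤n)
pattern 2<3 = s≤s (s≤s (s≤s z≤n))

-- Growth for y = 3 gives paths on n vertices that use the length 1 only twice; the steps of length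
-- 3 are uncounted here.  The ends are such that consecutive blocks can be linked by steps of length 3.
ascend₀ : ∀ j → ∃[ e ] (e ↗ 3 + j × Grid 3 0 below e above 2 0 (3 + j))
ascend₀ 0 = 2 , inj₁ refl ,
  grid (step (one refl) (step (one refl) stop))
    (up 0<3 (down 1<3 (up 2<3 []))) (sorted (0 ∷ 1 ∷ 2 ∷ []))
ascend₀ 1 = 1 , inj₂ refl ,
  grid (step (big refl) (step (one refl) (step (one refl) stop)))
    (up 0<3 (high refl (down 2<3 (up 1<3 [])))) (sorted (0 ∷ 3 ∷ 2 ∷ 1 ∷ []))
ascend₀ 2 = 4 , inj₁ refl ,
  grid (step (big refl) (step (one refl) (step (one refl) (step (big refl) stop))))
    (up 0<3 (high refl (down 2<3 (up 1<3 (high refl []))))) (sorted (0 ∷ 3 ∷ 2 ∷ 1 ∷ 4 ∷ []))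
ascend₀ (suc (suc (suc j))) with ascend₀ j
... | e , inj₁ eq , g = 3 + e , inj₁ (cong (3 +_) eq) , growGrid (m≤m+n 3 j) g
... | e , inj₂ eq , g = 3 + e , inj₂ (cong (3 +_) eq) , growGrid (m≤m+n 3 j) g

ascend₂ : ∀ j → ∃[ e ] (e ↗ 3 + j × Grid 3 2 below e above 2 0 (3 + j))
ascend₂ 0 = 0 , inj₂ refl ,
  grid (step (one refl) (step (one refl) stop))
    (up 2<3 (down 1<3 (up 0<3 []))) (sorted (2 ∷ 1 ∷ 0 ∷ []))
ascend₂ 1 = 3 , inj₁ refl ,
  grid (step (one refl) (step (one refl) (step (big refl) stop)))
    (up 2<3 (down 1<3 (up 0<3 (high refl [])))) (sorted (2 ∷ 1 ∷ 0 ∷ 3 ∷ []))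
ascend₂ 2 = 4 , inj₁ refl ,
  grid (step (one refl) (step (big refl) (step (one refl) (step (big refl) stop))))
    (up 2<3 (high refl (down 0<3 (up 1<3 (high refl []))))) (sorted (2 ∷ 3 ∷ 0 ∷ 1 ∷ 4 ∷ []))
ascend₂ (suc (suc (suc j))) with ascend₂ j
... | e , inj₁ eq , g = 3 + e , inj₁ (cong (3 +_) eq) , growGrid (m≤m+n 3 j) g
... | e , inj₂ eq , g = 3 + e , inj₂ (cong (3 +_) eq) , growGrid (m≤m+n 3 j) g

-- Mirror image of the ascending blocks: the start lies `above` and moves up with growth, while the
-- end stays at the bottom.
descend₀ : ∀ j → ∃[ e ] (e ↘ 0 × Grid 3 (2 + j) above e below 2 0 (3 + j))
descend₀ 0 = 0 , inj₁ refl ,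
  grid (step (one refl) (step (one refl) stop))
    (down 2<3 (up 1<3 (down 0<3 []))) (sorted (2 ∷ 1 ∷ 0 ∷ []))
descend₀ 1 = 2 , inj₂ refl ,
  grid (step (big refl) (step (one refl) (step (one refl) stop)))
    (high refl (down 0<3 (up 1<3 (down 2<3 [])))) (sorted (3 ∷ 0 ∷ 1 ∷ 2 ∷ []))
descend₀ 2 = 0 , inj₁ refl ,
  grid (step (big refl) (step (one refl) (step (one refl) (step (big refl) stop))))
    (high refl (down 1<3 (up 2<3 (high refl (down 0<3 []))))) (sorted (4 ∷ 1 ∷ 2 ∷ 3 ∷ 0 ∷ []))
descend₀ (suc (suc (suc j))) with e , exit , g ← descend₀ j = e , exit , growGrid (m≤m+n 3 j) g

descend₂ : ∀ j → ∃[ e ] (e ↘ 0 × Grid 3 j above e below 2 0 (3 + j))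
descend₂ 0 = 2 , inj₂ refl ,
  grid (step (one refl) (step (one refl) stop))
    (down 0<3 (up 1<3 (down 2<3 []))) (sorted (0 ∷ 1 ∷ 2 ∷ []))
descend₂ 1 = 0 , inj₁ refl ,
  grid (step (one refl) (step (one refl) (step (big refl) stop)))
    (down 1<3 (up 2<3 (high refl (down 0<3 [])))) (sorted (1 ∷ 2 ∷ 3 ∷ 0 ∷ []))
descend₂ 2 = 0 , inj₁ refl ,
  grid (step (one refl) (step (big refl) (step (one refl) (step (big refl) stop))))
    (down 2<3 (up 1<3 (high refl (high refl (down 0<3 []))))) (sorted (2 ∷ 1 ∷ 4 ∷ 3 ∷ 0 ∷ []))
descend₂ (suc (suc (suc j))) with e , exit , g ← descend₂ j = e , exit , growGrid (m≤m+n 3 j) g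

-- The vertex x lies outside the block; Exit tells how the block is left.
record Block (y x : ℕ) (Exit : ℕ → Set) (k n a b : ℕ) : Set where
  constructor block
  field
    {path} : List ℕ
    {exit} : ℕ
    walk   : Walk y x path exit a b
    cover  : path ↭ range k n
    leaves : Exit exit

enterBlock : ∀ {x s σ e τ} {Exit : ℕ → Set} y k j → ∣ x - k + s ∣ ≡ 3 → Grid 3 s σ e τ 2 0 (3 + j) → Exit (k + e) →
  Block y x Exit k (3 + j) 2 (suc j)
enterBlock {s = s} y k j enter (grid {p} w _ cover) leave with b , w′ , len ← countThrees y w =
  block (step (three enter) (recount refl b≡j (translate k w′)))
    (↭-trans (map⁺ (k +_) cover)
      (↭-reflexive (trans (map-range k 0 (3 + j)) (cong (λ i → range i (3 + j)) (+-identityʳ k)))))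
    leave
  where
  b≡j : b ≡ j
  b≡j = +-cancelˡ-≡ 3 b j (trans (cong suc len) (↭-range-length cover))

-- Entry is by a step of length 3 in either case: from just below the block it reaches the third
-- vertex, otherwise the first. Hence the two families of starts.
ascend : ∀ {x k} y j → x ↗ k → Block y x (_↗ 3 + j + k) k (3 + j) 2 (suc j)
ascend {x} {k} y j (inj₁ eq) with e , exit , g ← ascend₂ j =
  enterBlock y k j (distance 3 (trans (+-comm k 2) (cong (2 +_) eq))) g (↗-+ k exit)
ascend {x} {k} y j (inj₂ eq) with e , exit , g ← ascend₀ j =
  enterBlock y k j (distance 3 (trans (+-identityʳ k) eq)) g (↗-+ k exit)

descend : ∀ {x} y k j → x ↘ 3 + j + k → Block y x (_↘ k) k (3 + j) 2 (suc j)
descend {x} y k j enter with enter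
... | inj₁ eq with e , exit , g ← descend₂ j =
  enterBlock y k j (distance′ 3 (trans eq (cong (3 +_) (+-comm j k)))) g (↘-+ k exit)
... | inj₂ eq with e , exit , g ← descend₀ j =
  enterBlock y k j (distance′ 3 (trans eq (trans (cong (5 +_) (+-comm j k)) (cong (3 +_) (twoMore k j))))) g (↘-+ k exit)
  where
  twoMore : ∀ k j → 2 + (k + j) ≡ k + (2 + j)
  twoMore = solve-∀

-- Blocks of fewer than three vertices are traversed directly, and their ones depend on the entering
-- step; from three vertices on the count is fixed.
record FewOnes (n a b : ℕ) : Set where
  constructor fewOnes
  field
    total   : a + b ≡ n
    atMost  : a ≤ 2
    exactly : 3 ≤ n → a ≡ 2

ascendAny : ∀ {x k} y n → x ↗ k → ∃[ a ] ∃[ b ] (Block y x (_↗ n + k) k n a b × FewOnes n a b)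
ascendAny y 0 enter = 0 , 0 , block stop refl enter , fewOnes refl z≤n (λ ())
ascendAny y 1 enter with i , j , s , total , i≤1 ← enter↗ y enter =
  i , j , block (single s) refl (inj₁ refl) , fewOnes total (m≤n⇒m≤1+n i≤1) (λ { (s≤s ()) })
ascendAny {k = k} y 2 enter with i , j , s , total , i≤1 ← enter↗ y enter =
  i + 1 , j + 0 , block (single s ▷ straight y k 1) refl (inj₁ refl) ,
  fewOnes (trans (rearrange i j) (cong suc total)) (+-monoˡ-≤ 1 i≤1) (λ { (s≤s (s≤s ())) })
  where
  rearrange : ∀ i j → (i + 1) + (j + 0) ≡ 1 + (i + j)
  rearrange = solve-∀
ascendAny y (suc (suc (suc n))) enter = 2 , suc n , ascend y n enter , fewOnes refl ≤-refl (λ _ → refl)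

descendAny : ∀ {x} y k n → x ↘ n + k → ∃[ a ] ∃[ b ] (Block y x (_↘ k) k n a b × FewOnes n a b)
descendAny y k 0 enter = 0 , 0 , block stop refl enter , fewOnes refl z≤n (λ ())
descendAny y k 1 enter with i , j , s , total , i≤1 ← enter↘ y enter =
  i , j , block (single s) refl (inj₁ refl) , fewOnes total (m≤n⇒m≤1+n i≤1) (λ { (s≤s ()) })
descendAny y k 2 enter with i , j , s , total , i≤1 ← enter↘ y enter =
  i + 1 , j + 0 , block (single s ▷ straightDown y k 1) (swap _ _ refl) (inj₁ refl) ,
  fewOnes (trans (rearrange i j) (cong suc total)) (+-monoˡ-≤ 1 i≤1) (λ { (s≤s (s≤s ())) })
  where
  rearrange : ∀ i j → (i + 1) + (j + 0) ≡ 1 + (i + j)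
  rearrange = solve-∀
descendAny y k (suc (suc (suc n))) enter = 2 , suc n , descend y k n enter , fewOnes refl ≤-refl (λ _ → refl)

-- Grids of columns

record Standard (y a b w : ℕ) : Set where
  constructor standard
  field
    {path} : List ℕ
    {exit} : ℕ
    walk   : Walk y 0 path exit a b
    cover  : 0 ∷ path ↭ range 0 w

raise-below : ∀ y k x → raise y below k x ≡ x
raise-below y zero    x = refl
raise-below y (suc k) x = raise-below y k x

raise-above : ∀ y k x → raise y above k x ≡ k * y + x
raise-above y zero    x = refl
raise-above y (suc k) x = trans (cong (y +_) (raise-above y k x)) (sym (+-assoc y (k * y) x))

-- Each growth adds `y` steps of length `y` and leaves the other counts alone; the start `0`, being
-- on side `below`, stays in place.
fromGrid : ∀ {y e τ a b w} k → y ≤ w → Grid y 0 below e τ a b w → Standard y a b (k * y + w)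
fromGrid {y} {w = w} k y≤w g with growGrids k y≤w g
... | grid walk _ cover rewrite raise-below y k 0 | raise-above y k w = standard walk cover

cover-double : ∀ {α β γ r t y} → α ↭ range 0 r → β ↭ range r t → r + t ≡ y → γ ↭ α ++ map (y +_) α →
  γ ++ β ↭ range 0 (y + r)
cover-double {α} {β} {γ} {r} {t} {y} coverα coverβ refl coverγ =
  ↭-trans (++⁺ coverγ coverβ)
  (↭-trans (solve 3 (λ a a′ b → (a ⊕ a′) ⊕ b ⊜ (a ⊕ b) ⊕ a′) ↭-refl α (map (y +_) α) (range r t))
  (↭-trans (++⁺ (++⁺ʳ (range r t) coverα) (map⁺ (y +_) coverα))
  (↭-reflexive (trans (cong₂ _++_ low (map-range y 0 r)) (sym (range-+ 0 y r))))))
  where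
  low : range 0 r ++ range r t ≡ range 0 y
  low = sym (trans (range-+ 0 r t) (cong (λ i → range 0 r ++ range i t) (+-identityʳ r)))

cover-after-column : ∀ {α β γ r t y} → α ↭ range 1 r → β ↭ range (suc r) t → suc r + t ≡ y →
  γ ↭ α ++ map (y +_) α → 0 ∷ y ∷ β ++ γ ↭ range 0 (y + suc r)
cover-after-column {α} {β} {γ} {y = y} coverα coverβ eq coverγ =
  ↭-trans (prep 0 (prep y (++-comm β γ)))
  (cover-double (prep 0 coverα) coverβ eq
    (prep 0 (↭-trans (prep y coverγ)
      (↭-trans (↭-sym (shift y α (map (y +_) α))) (↭-reflexive (cong (λ i → α ++ i ∷ map (y +_) α) (sym (+-identityʳ y))))))))

-- The grid consists of the columns x, y + x, y + 2x, … for x < y.  The first r columns have an extra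
-- vertex on top, so that steps between them and the others are only possible at the bottom.
layoutRight : ∀ {y s σ α u β e τ r t a b a′ b′} →
  Walk y s α u a b → Run y σ (s ∷ α) below → s ∷ α ↭ range 0 r →
  Walk y u β e a′ b′ → Run y below β τ → β ↭ range r t → r + t ≡ y →
  Grid y (lift y σ s) σ e τ (a + a′) (b + b′) (y + r)
layoutRight {β = β} {r = r} {t} wα rα coverα wβ rβ coverβ eq with q , head , w ← grow-head rα wα =
  grid (w ▷ wβ) (subst (λ l → Run _ _ (l ++ β) _) head (grow-run rα ⋈ rβ))
    (subst (λ l → l ++ β ↭ _) head
      (cover-double coverα coverβ eq
        (grow-↭-small rα (↭-range-< coverα (≤-trans (m≤m+n r t) (≤-reflexive eq))))))

climb : ∀ y → Step y ∣ 0 - y ∣ 0 0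
climb y = big refl

high₀ : ∀ {y p s} → Run y above p s → Run y above (y ∷ p) s
high₀ {y} r = high {x = 0} (sym (+-identityʳ y)) r

-- From the top of column 0, the lower columns are reached through y - 1 or y - 3, as the
-- top of the last column is one step of length 1 below the top of column 0.
layoutLeft : ∀ {y α u β e σ r t a b a′ b′} →
  Walk y y β u a b → Run y above β below → β ↭ range (suc r) t →
  Walk y u α e a′ b′ → Run y below α σ → α ↭ range 1 r → suc r + t ≡ y →
  Grid y 0 below (lift y σ e) σ (a + a′) (b + b′) (y + suc r)
layoutLeft {y} {r = r} {t} wβ rβ coverβ wα rα coverα eq =
  grid (step (climb y) (wβ ▷ grow-walk rα wα)) (up (≤-trans (s≤s z≤n) le) (high₀ (rβ ⋈ grow-run rα)))
    (cover-after-column coverα coverβ eq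
      (grow-↭-small rα (↭-range-< coverα le)))
  where
  le : suc r ≤ y
  le = ≤-trans (m≤m+n (suc r) t) (≤-reflexive eq)

-- Only column `0` is higher, and it is left at once from its top. No later step joins columns of
-- unequal height, so parity does not matter.
layoutLeft₀ : ∀ {y β e t a b} → Walk y y β e a b → β ↭ range 1 t → suc t ≡ y →
  Grid y 0 below e (flips above t) a b (y + 1)
layoutLeft₀ {y} {β} {t = t} w cover eq =
  grid (step (climb y) w)
    (up (≤-trans (s≤s z≤n) (≤-reflexive eq)) (high₀ (alternating-range above cover (≤-reflexive eq) refl)))
    (↭-trans (↭-reflexive (cong (λ p → 0 ∷ y ∷ p) (sym (++-identityʳ β)))) (cover-after-column refl cover eq refl))

-- The last two columns u and v are traversed from the top of u to the bottom of u.  This trades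
-- one step of length y for a second step from u to v, which settles the parity.
turnPath : ℕ → ℕ → ℕ → List ℕ
turnPath y u v = y + u ∷ y + v ∷ v ∷ u ∷ []

turn-walk : ∀ {y x u v i j i′ j′} → Step y ∣ x - u ∣ i j → Step y ∣ u - v ∣ i′ j′ →
  Walk y (y + x) (turnPath y u v) u (i + (i′ + i′)) (j + (j′ + j′))
turn-walk {y} {x} {u} {v} {i} {j} {i′} {j′} s₁ s₂ =
  recount (cong (i +_) (cong (i′ +_) (+-identityʳ i′))) (cong (j +_) (cong (j′ +_) (+-identityʳ j′)))
    (step (relength (sym (∣m+n-m+o∣≡∣n-o∣ y x u)) s₁)
    (step (relength (sym (∣m+n-m+o∣≡∣n-o∣ y u v)) s₂)
    (step (big (distance′ y refl))
    (step (relength (∣-∣-comm u v) s₂) stop))))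

-- Further growth extends `v` downwards and then `u` upwards, so the path comes to end one vertex
-- below the top of column `u`.
turn-run : ∀ {y u v} → All (_< y) (u ∷ v ∷ []) → Run y above (turnPath y u v) above
turn-run (u<y ∷ v<y ∷ []) = high refl (high refl (down v<y (up u<y [])))

turn-↭ : ∀ {y σ α τ u v} (rα : Run y σ α τ) → All (_< y) (α ++ u ∷ v ∷ []) →
  grow rα ++ turnPath y u v ↭ (α ++ u ∷ v ∷ []) ++ map (y +_) (α ++ u ∷ v ∷ [])
turn-↭ {y} {α = α} {u = u} {v} rα small =
  ↭-trans (++⁺ʳ _ (grow-↭-small rα (++⁻ˡ α small)))
  (↭-trans (solve 6 (λ a a′ u v u′ v′ → (a ⊕ a′) ⊕ (u′ ⊕ v′ ⊕ v ⊕ u) ⊜ (a ⊕ u ⊕ v) ⊕ (a′ ⊕ u′ ⊕ v′)) ↭-refl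
      α (map (y +_) α) (u ∷ []) (v ∷ []) (y + u ∷ []) (y + v ∷ []))
  (↭-reflexive (cong ((α ++ u ∷ v ∷ []) ++_) (sym (map-++ (y +_) α (u ∷ v ∷ []))))))

layoutTurn : ∀ {y α m β x u v r t a b a′ b′ i j i′ j′} →
  Walk y y β m a b → Run y above β below → β ↭ range (suc r) t →
  Walk y m α x a′ b′ → Run y below α above → α ++ u ∷ v ∷ [] ↭ range 1 r → suc r + t ≡ y →
  Step y ∣ x - u ∣ i j → Step y ∣ u - v ∣ i′ j′ →
  Grid y 0 below u above (a + (a′ + (i + (i′ + i′)))) (b + (b′ + (j + (j′ + j′)))) (y + suc r)
layoutTurn {y} {α} {r = r} {t} wβ rβ coverβ wα rα coverα eq s₁ s₂ =
  grid (step (climb y) (wβ ▷ grow-walk rα wα ▷ turn-walk s₁ s₂))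
    (up (≤-trans (s≤s z≤n) le) (high₀ (rβ ⋈ grow-run rα ⋈ turn-run (++⁻ʳ α small))))
    (cover-after-column coverα coverβ eq (turn-↭ rα small))
  where
  le : suc r ≤ y
  le = ≤-trans (m≤m+n (suc r) t) (≤-reflexive eq)
  small : All (_< y) (α ++ _ ∷ _ ∷ [])
  small = ↭-range-< coverα le

-- The case that needs a turn: y and the residue of c mod y are both odd, so that layoutRight and
-- layoutLeft would have to step between columns of unequal height on the wrong side.
record Odd (y c : ℕ) : Set where
  constructor odd
  field
    k r t  : ℕ
    c≡     : c ≡ k * y + (3 + r)
    total  : 4 + r + t ≡ y
    -- The residue is `3 + r`, and `flips below (3 + r)` computes to `flips above r`: the residue is
    -- odd and `r` itself even.
    r-odd  : flips above r ≡ above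
    y-odd  : flips below y ≡ above

data Residue (y c : ℕ) : Set where
  zero    : ∀ k → c ≡ k * y → Residue y c
  one     : ∀ k → c ≡ k * y + 1 → Residue y c
  even    : ∀ k r t → c ≡ k * y + suc r → suc r + t ≡ y → flips below (suc r) ≡ below → Residue y c
  oddEven : ∀ k r t → c ≡ k * y + suc r → suc r + t ≡ y → flips below (suc r) ≡ above → flips below y ≡ below →
    Residue y c
  oddOdd  : Odd y c → Residue y c

residue : ∀ y c → 0 < y → Residue y c
residue y@(suc _) c _ = analyse (c % y) (m%n<n c y) (trans (m≡m%n+[m/n]*n c y) (+-comm (c % y) (c / y * y)))
  where
  side : ∀ n → flips below n ≡ below ⊎ flips below n ≡ above
  side n with flips below n
  ... | below = inj₁ refl
  ... | above = inj₂ refl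
  analyse : ∀ r → r < y → c ≡ c / y * y + r → Residue y c
  analyse zero r<y eq = zero (c / y) (trans eq (+-identityʳ _))
  analyse (suc r) r<y eq with t , total ← m≤n⇒∃[o]m+o≡n (<⇒≤ r<y) | side (suc r)
  ... | inj₁ r-even = even (c / y) r t eq total r-even
  ... | inj₂ r-odd with r
  -- Residue 1 needs no parity condition; any other odd residue is at least 3, which leaves room for
  -- a turn.
  ...   | 0 = one (c / y) eq
  ...   | suc (suc r′) with side y
  ...     | inj₁ y-even = oddEven (c / y) (2 + r′) t eq total r-odd y-even
  ...     | inj₂ y-odd with t′ , total′ ← m≤n⇒∃[o]m+o≡n r<y = oddOdd (odd (c / y) r′ t′ eq total′ r-odd y-odd)

-- Straight column orders and parity

flips-rest : ∀ s r t {σ τ} → flips s r ≡ σ → flips s (r + t) ≡ τ → flips σ t ≡ τ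
flips-rest s r t refl eq = trans (sym (flips-+ s r t)) eq

flips-flip : ∀ s n {τ} → flips s n ≡ τ → flips (opposite s) n ≡ opposite τ
flips-flip s n refl = flips-opposite s n

-- A turn has `d = 1`: it makes one more counted step, hence has one more vertex for the same `c`.
-- Without a turn, `d = 0`.
widen : ∀ {y a b w c d} k r → c ≡ k * y + r → w ≡ y + (d + r) →
  Standard y a b (k * y + w) → Standard y a b (d + (y + c))
widen {y} {d = d} k r refl refl = subst (Standard y _ _) (rearrange (k * y) y d r)
  where
  rearrange : ∀ n y d r → n + (y + (d + r)) ≡ d + (y + (n + r))
  rearrange = solve-∀

restate : ∀ {y a a′ b w} → a ≡ a′ → Standard y a b w → Standard y a′ b w
restate refl p = p

-- The side `σ` of the start is left free because one path in case (4) begins at the top of column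
-- `0`.
straightRight : ∀ {y} σ r t → suc r + t ≡ y → flips σ (suc r) ≡ below →
  Grid y (lift y σ 0) σ (t + (r + 0)) (flips below t) (r + t) 0 (y + suc r)
straightRight {y} σ r t eq r-even =
  layoutRight (straight y 0 r)
    (alternating-range σ refl (≤-trans (m≤m+n (suc r) t) (≤-reflexive eq)) r-even) refl
    (straight y (r + 0) t)
    (alternating-range below refl (≤-trans (+-monoˡ-≤ t (s≤s (≤-reflexive (+-identityʳ r)))) (≤-reflexive eq)) refl)
    (↭-reflexive (cong (λ i → range (suc i) t) (+-identityʳ r)))
    eq

leftwards : ∀ {x} y k n → n + k ≡ x → Walk y x (countdown k n) k n 0
leftwards y k n refl = straightDown y k n

-- After column `4` come `3, 2, 1` or `1, 2, 3`; the second order is entered by a step of length 3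
-- in place of a one.
straightTurn : ∀ {y x v i j} r t → 4 + r + t ≡ y → flips above r ≡ above → flips below y ≡ above →
  Step y ∣ 4 - x ∣ i j → ∣ x - 2 ∣ ≡ 1 → ∣ 2 - v ∣ ≡ 1 → x ∷ 2 ∷ v ∷ [] ↭ range 1 3 →
  Grid y 0 below 2 above (3 + r + t + i) j (y + (4 + r))
straightTurn {y} {x} {v} {i} {j} r t eq r-odd y-odd s₀ s₁ s₂ last =
  subst₂ (λ a b → Grid y 0 below 2 above a b (y + (4 + r))) (sumOnes t r i) (sumThrees j)
    (layoutTurn
      (leftwards y (4 + r) t (trans (+-comm t (4 + r)) eq))
      (alternating-range above (countdown-↭ (4 + r) t) (≤-reflexive eq)
        (flips-flip below t (flips-rest below (4 + r) t (flips-flip above r r-odd) (trans (cong (flips below) eq) y-odd))))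
      (countdown-↭ (4 + r) t)
      (leftwards y 4 r (+-comm r 4) ▷ single s₀)
      (subst (Run y below _) length-α (alternating below (++⁻ˡ _ smallα)))
      coverα eq (one s₁) (one s₂))
  where
  sumOnes : ∀ t r i → t + (r + i + (1 + (1 + 1))) ≡ 3 + r + t + i
  sumOnes = solve-∀
  sumThrees : ∀ j → 0 + (0 + j + (0 + (0 + 0))) ≡ j
  sumThrees = solve-∀
  coverα : (countdown 4 r ++ x ∷ []) ++ 2 ∷ v ∷ [] ↭ range 1 (3 + r)
  coverα = ↭-trans (↭-reflexive (++-assoc (countdown 4 r) (x ∷ []) (2 ∷ v ∷ [])))
    (↭-trans (++-comm (countdown 4 r) (x ∷ 2 ∷ v ∷ [])) (++⁺ last (countdown-↭ 4 r)))
  smallα : All (_< y) ((countdown 4 r ++ x ∷ []) ++ 2 ∷ v ∷ [])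
  smallα = ↭-range-< coverα (≤-trans (m≤m+n (4 + r) t) (≤-reflexive eq))
  length-α : flips below (length (countdown 4 r ++ x ∷ [])) ≡ above
  length-α = trans (cong (flips below)
    (trans (length-++ (countdown 4 r)) (trans (cong (_+ 1) (↭-range-length (countdown-↭ 4 r))) (+-comm r 1)))) r-odd

straightStandard : ∀ m c → Standard (suc m) m 0 (suc m + c) ⊎ Odd (suc m) c
straightStandard m c with residue (suc m) c (s≤s z≤n)
... | zero k eq =
  inj₁ (subst (Standard _ m 0) (trans (+-comm (k * suc m) (suc m)) (cong (suc m +_) (sym eq)))
    (fromGrid k ≤-refl (grid (straight (suc m) 0 m) (alternating-range below refl ≤-refl refl) refl)))
... | one k eq =
  inj₁ (widen {d = 0} k 1 eq refl
    (fromGrid k (m≤m+n (suc m) 1)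
      (layoutLeft₀ (leftwards (suc m) 1 m (+-comm m 1)) (countdown-↭ 1 m) refl)))
... | even k r t eq total r-even =
  inj₁ (widen {d = 0} k (suc r) eq refl
    (restate (suc-injective total)
      (fromGrid k (m≤m+n (suc m) (suc r)) (straightRight below r t total r-even))))
... | oddEven k r t eq total r-odd y-even =
  inj₁ (widen {d = 0} k (suc r) eq refl
    (restate (trans (+-comm t r) (suc-injective total))
      (fromGrid k (m≤m+n (suc m) (suc r))
        (layoutLeft
          (leftwards (suc m) (suc r) t (trans (+-comm t (suc r)) total))
          (alternating-range above (countdown-↭ (suc r) t) (≤-reflexive total)
            (flips-rest below (suc r) t r-odd (trans (cong (flips below) total) y-even)))
          (countdown-↭ (suc r) t)
          (leftwards (suc m) 1 r (+-comm r 1))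
          (alternating-range below (countdown-↭ 1 r) (≤-trans (m≤m+n (suc r) t) (≤-reflexive total)) refl)
          (countdown-↭ 1 r) total))))
... | oddOdd o = inj₂ o

turnStandard : ∀ m c → Odd (suc m) c →
  Standard (suc m) (suc m) 0 (1 + (suc m + c)) × Standard (suc m) m 1 (1 + (suc m + c))
turnStandard m c (odd k r t eq total r-odd y-odd) =
  ( turned (+-comm (3 + r + t) 1)
      (straightTurn r t total r-odd y-odd (one refl) refl refl (sorted (3 ∷ 2 ∷ 1 ∷ [])))
  , turned (+-identityʳ (3 + r + t))
      (straightTurn r t total r-odd y-odd (three refl) refl refl refl) )
  where
  turned : ∀ {b i d} → 3 + r + t + i ≡ d + (3 + r + t) →
    Grid (suc m) 0 below 2 above (3 + r + t + i) b (suc m + (4 + r)) →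
    Standard (suc m) (d + m) b (1 + (suc m + c))
  turned {d = d} count g =
    widen {d = 1} k (3 + r) eq refl
      (restate (trans count (cong (d +_) (suc-injective total)))
        (fromGrid k (m≤m+n (suc m) (4 + r)) g))

-- Cases (1) and (3)

-- Connecting the residue classes mod 3 takes at least two steps of length 1.
data Linkable : ℕ → ℕ → Set where
  onesOnly : ∀ {a} → Linkable a 0
  mixed    : ∀ {a b} → Linkable (2 + a) (suc b)

linkable : ∀ {a b} → 2 ≤ a → Linkable a b
linkable {b = zero}  _                = onesOnly
linkable {b = suc b} (s≤s (s≤s z≤n)) = mixed

-- Ones beyond two go into a straight stretch; a single block takes the other two and all the
-- threes.
ascending : ∀ y a b → Linkable a b → ∃[ p ] ∃[ e ] (Walk y 0 p e a b × p ↭ range 1 (a + b))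
ascending y a .0 onesOnly =
  range 1 a , a + 0 , straight y 0 a , ↭-reflexive (cong (range 1) (sym (+-identityʳ a)))
ascending y (suc (suc j)) (suc b) mixed with block {p} {e} w cover _ ← ascend {k = suc (j + 0)} y b (inj₁ refl) =
  range 1 j ++ p , e , recount (+-comm j 2) refl (straight y 0 j ▷ w) ,
  ↭-trans (++⁺ˡ (range 1 j) cover)
    (↭-reflexive (trans (cong (λ i → range 1 j ++ range i (3 + b)) (sym (+-suc j 0)))
      (trans (sym (range-+ 1 j (3 + b))) (cong (range 1) (rearrange j b)))))
  where
  rearrange : ∀ j b → j + (3 + b) ≡ 2 + j + suc b
  rearrange = solve-∀

descending : ∀ {x} y k a b → Linkable a b → a + b + k ≡ x → ∃[ p ] ∃[ e ] (Walk y x p e a b × p ↭ range k (a + b))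
descending y k a .0 onesOnly refl =
  countdown k (a + 0) , k , recount (+-identityʳ a) refl (straightDown y k (a + 0)) , countdown-↭ k (a + 0)
descending y k (suc (suc j)) (suc b) mixed eq with block {p} {e} w cover _ ← descend {3 + b + k} y k b (inj₁ refl) =
  countdown (3 + b + k) j ++ p , e ,
  recount (+-comm j 2) refl (leftwards y (3 + b + k) j (trans (rearrange j b k) eq) ▷ w) ,
  ↭-trans (++-comm (countdown (3 + b + k) j) p)
  (↭-trans (++⁺ cover (countdown-↭ (3 + b + k) j))
  (↭-reflexive (trans (sym (range-+ k (3 + b) j)) (cong (range k) (rearrange′ j b)))))
  where
  rearrange : ∀ j b k → j + (3 + b + k) ≡ 2 + j + suc b + k
  rearrange = solve-∀
  rearrange′ : ∀ j b → 3 + b + j ≡ 2 + j + suc b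
  rearrange′ = solve-∀

relocate : ∀ {y x x′ p e a b} → x ≡ x′ → Walk y x p e a b → Walk y x′ p e a b
relocate refl w = w

-- A path descending from `a + b` is reversed so that it ends at `a + b`, the translate of the start
-- `0`.
prepend : ∀ {y a b a′ b′ w} → Linkable a b → Standard y a′ b′ w →
  ∃[ s ] ∃[ p ] ∃[ e ] (Walk y s p e (a + a′) (b + b′) × s ∷ p ↭ range 0 (a + b + w))
prepend {y} {a} {b} {w = w} link (standard {p} walk cover)
  with p₀ , s , w₀ , cover₀ ← descending y 0 a b link (+-identityʳ (a + b))
  with q , w₁ , cover₁ ← reverseWalk w₀ =
  s , q ++ map (a + b +_) p , _ ,
  w₁ ▷ relocate (+-identityʳ (a + b)) (translate (a + b) walk) ,
  ↭-trans (++⁺ʳ _ cover₁)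
  (↭-trans (↭-sym (shift (a + b) p₀ _))
  (↭-trans (++⁺ cover₀
    (↭-trans (↭-reflexive (cong (_∷ map (a + b +_) p) (sym (+-identityʳ (a + b))))) (map⁺ (a + b +_) cover)))
  (↭-reflexive (trans (cong (range 0 (a + b) ++_) (map-range (a + b) 0 w)) (sym (range-+ 0 (a + b) w))))))

finish : ∀ {y a b a₁ b₁ a₂ b₂} c → Linkable a₁ b₁ → Standard y a₂ b₂ (suc (a₂ + b₂ + c)) → a₁ + a₂ ≡ a → b₁ + b₂ ≡ b →
  HasLinearRealization (a + b + c + 1) (L13y a b c y)
finish {a₁ = a₁} {b₁} {a₂} {b₂} c link path refl refl with s , p , e , walk , cover ← prepend link path =
  realize (a₁ + a₂) (b₁ + b₂) c walk (subst (λ i → s ∷ p ↭ range 0 i) (rearrange a₁ b₁ a₂ b₂ c) cover)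
  where
  rearrange : ∀ a₁ b₁ a₂ b₂ c → a₁ + b₁ + suc (a₂ + b₂ + c) ≡ a₁ + a₂ + (b₁ + b₂) + c + 1
  rearrange = solve-∀

manyOnes : ∀ y a b c → 0 < y → y + 1 ≤ a → HasLinearRealization (a + b + c + 1) (L13y a b c y)
manyOnes (suc m) a b c _ le with d , refl ← m≤n⇒∃[o]m+o≡n le = assemble b (straightStandard m c)
  where
  oneMore : ∀ m d → 1 + d + suc m ≡ suc m + 1 + d
  oneMore = solve-∀
  twoMore : ∀ m d → 2 + d + m ≡ suc m + 1 + d
  twoMore = solve-∀
  assemble : ∀ b → Standard (suc m) m 0 (suc m + c) ⊎ Odd (suc m) c →
    HasLinearRealization (suc m + 1 + d + b + c + 1) (L13y (suc m + 1 + d) b c (suc m))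
  assemble b (inj₁ path) =
    finish c (linkable (s≤s (s≤s z≤n)))
      (subst (λ i → Standard (suc m) m 0 (suc (i + c))) (sym (+-identityʳ m)) path)
      (twoMore m d) (+-identityʳ b)
  -- The turn takes `y` ones and leaves `1 + d`. If there are threes, using one of them inside the
  -- turned path keeps the two ones that `Linkable` asks for.
  assemble zero (inj₂ o) =
    finish {a₁ = 1 + d} c onesOnly
      (subst (λ i → Standard (suc m) (suc m) 0 (suc (i + c))) (sym (+-identityʳ (suc m))) (proj₁ (turnStandard m c o)))
      (oneMore m d) refl
  assemble (suc b) (inj₂ o) =
    finish c (linkable (s≤s (s≤s z≤n)))
      (subst (λ i → Standard (suc m) m 1 (suc (i + c))) (+-comm 1 m) (proj₂ (turnStandard m c o)))
      (twoMore m d) (+-comm b 1)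

-- A part with threes needs two ones, hence `4 ≤ a`. If `m ≤ 2 + b`, the second part takes two ones
-- and `m - 2` threes; otherwise it takes all the threes and the first part has ones only.
split : ∀ a b m → 4 ≤ a → 2 ≤ m → m ≤ a + b →
  ∃[ a₁ ] ∃[ b₁ ] ∃[ a₂ ] ∃[ b₂ ] (Linkable a₁ b₁ × Linkable a₂ b₂ × a₂ + b₂ ≡ m × a₁ + a₂ ≡ a × b₁ + b₂ ≡ b)
split a b m 4≤a 2≤m m≤a+b with m ≤? 2 + b
... | yes m≤2+b with a′ , refl ← m≤n⇒∃[o]m+o≡n 4≤a | m′ , refl ← m≤n⇒∃[o]m+o≡n 2≤m
    with b′ , refl ← m≤n⇒∃[o]m+o≡n (+-cancelˡ-≤ 2 m′ b m≤2+b) =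
  2 + a′ , b′ , 2 , m′ , linkable (s≤s (s≤s z≤n)) , linkable ≤-refl , refl , +-comm (2 + a′) 2 , +-comm b′ m′
... | no m≰2+b with d , refl ← m≤n⇒∃[o]m+o≡n (≰⇒> m≰2+b) with e , eq ← m≤n⇒∃[o]m+o≡n m≤a+b =
  e , 0 , 3 + d , b , onesOnly , linkable (s≤s (s≤s z≤n)) , cong (3 +_) (+-comm d b) ,
  +-cancelʳ-≡ b _ _ (trans (rearrange e d b) eq) , refl
  where
  rearrange : ∀ e d b → e + (3 + d) + b ≡ 3 + b + d + e
  rearrange = solve-∀

-- All columns, except possibly column `0`, have equal height, so any order will do: `ascending`
-- from `0`, or `descending` from `y`, the top of column `0`.
nearMultiple : ∀ y a b c → 3 < y → 4 ≤ a → y + 1 ≤ a + b → ∃[ k ] (c ≡ k * y ⊎ c ≡ k * y + 1) →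
  HasLinearRealization (a + b + c + 1) (L13y a b c y)
nearMultiple (suc m) a b c (s≤s 3≤m) 4≤a le (k , c-residue)
  with a₁ , b₁ , a₂ , b₂ , link₁ , link₂ , refl , eqa , eqb ←
    split a b m 4≤a (<⇒≤ 3≤m) (≤-trans (n≤1+n m) (≤-trans (m≤m+n (suc m) 1) le))
  with c-residue
... | inj₁ refl with p , e , w , cover ← ascending (suc m) a₂ b₂ link₂ =
  finish c link₁
    (subst (Standard (suc m) a₂ b₂) (+-comm (k * suc m) (suc m))
      (fromGrid k ≤-refl (grid w (alternating-range below (prep 0 cover) ≤-refl refl) (prep 0 cover))))
    eqa eqb
... | inj₂ refl with p , e , w , cover ← descending (suc m) 1 a₂ b₂ link₂ (+-comm m 1) =
  finish c link₁
    (widen {d = 0} k 1 refl refl (fromGrid k (m≤m+n (suc m) 1) (layoutLeft₀ w cover refl)))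
    eqa eqb

-- Case (2)

-- The turn repeats the last step of a column order, which has to be split off from a walk built
-- from the front.
record Unsnoc (y x : ℕ) (p : List ℕ) (e a b : ℕ) : Set where
  constructor unsnoced
  field
    {init}    : List ℕ
    {before}  : ℕ
    {a′ b′ i j} : ℕ
    split-p   : p ≡ init ++ e ∷ []
    walk      : Walk y x init before a′ b′
    last      : Step y ∣ before - e ∣ i j
    ones      : a ≡ a′ + i
    threes    : b ≡ b′ + j

unsnoc : ∀ {y x p e a b} → 0 < length p → Walk y x p e a b → Unsnoc y x p e a b
unsnoc _ (step s stop) = unsnoced refl stop s (+-identityʳ _) (+-identityʳ _)
unsnoc _ (step {z = z} {i = i} {j} s w@(step _ _)) with unsnoc (s≤s z≤n) w
... | unsnoced {a′ = a′} {b′} {i′} {j′} eq w′ last ones threes =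
  unsnoced (cong (z ∷_) eq) (step s w′) last
    (trans (cong (i +_) ones) (sym (+-assoc i a′ i′))) (trans (cong (j +_) threes) (sym (+-assoc j b′ j′)))

counted≤length : ∀ {y x p e a b} → Walk y x p e a b → a + b ≤ length p
counted≤length stop = z≤n
counted≤length (step (one _) w) = s≤s (counted≤length w)
counted≤length (step {a = a} {b} (three _) w) = ≤-trans (≤-reflexive (+-suc a b)) (s≤s (counted≤length w))
counted≤length (step (big _) w) = m≤n⇒m≤1+n (counted≤length w)

step≤1 : ∀ {y l i j} → Step y l i j → i + j ≤ 1
step≤1 (one _)   = ≤-refl
step≤1 (three _) = ≤-refl
step≤1 (big _)   = z≤n

length-snoc : ∀ (p : List ℕ) z → length (p ++ z ∷ []) ≡ suc (length p)
length-snoc p z = trans (length-++ p) (+-comm (length p) 1)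

-- The bounds are such that, if a ≥ 7 and b ≥ y - 4, at least two ones are left over for prepend.
record Sparse (y c : ℕ) : Set where
  constructor sparse
  field
    {a b}   : ℕ
    a≤5     : a ≤ 5
    b+4≤y   : b + 4 ≤ y
    path    : Standard y a b (suc (a + b + c))

tight : ∀ {y a b c} → 3 ≤ a → a ≤ 5 → suc (a + b) ≡ y → Standard y a b (y + c) → Sparse y c
tight {a = a} {b} 3≤a a≤5 refl path =
  sparse a≤5 (≤-trans (≤-reflexive (+-comm b 4)) (s≤s (+-monoˡ-≤ b 3≤a))) path

-- A turn makes `y` counted steps instead of `y - 1`, so one more of them must be a one to keep
-- `b + 4 ≤ y`.
loose : ∀ {y a b c} → 4 ≤ a → a ≤ 5 → a + b ≡ y → Standard y a b (1 + (y + c)) → Sparse y c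
loose {a = a} {b} 4≤a a≤5 refl path =
  sparse a≤5 (≤-trans (≤-reflexive (+-comm b 4)) (+-monoˡ-≤ b 4≤a)) path

module _ {n₁ a₁ b₁ n₂ a₂ b₂} (few₁ : FewOnes n₁ a₁ b₁) (few₂ : FewOnes n₂ a₂ b₂) where
  open FewOnes

  fewOnes-total : suc (1 + (a₁ + a₂) + (b₁ + b₂)) ≡ 2 + n₁ + n₂
  fewOnes-total = trans (rearrange a₁ a₂ b₁ b₂) (cong₂ (λ m n → 2 + m + n) (total few₁) (total few₂))
    where
    rearrange : ∀ a₁ a₂ b₁ b₂ → suc (1 + (a₁ + a₂) + (b₁ + b₂)) ≡ 2 + (a₁ + b₁) + (a₂ + b₂)
    rearrange = solve-∀

  fewOnes-≤ : 1 + (a₁ + a₂) ≤ 5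
  fewOnes-≤ = s≤s (+-mono-≤ (atMost few₁) (atMost few₂))

  -- One of the blocks has at least three vertices and so exactly two ones; the summand 1 is the
  -- straight step in front of the blocks.
  fewOnes-≥ : 5 ≤ n₁ + n₂ → 3 ≤ 1 + (a₁ + a₂)
  fewOnes-≥ le with 3 ≤? n₁
  ... | yes 3≤n₁ = s≤s (≤-trans (≤-reflexive (sym (exactly few₁ 3≤n₁))) (m≤m+n a₁ a₂))
  ... | no 3≰n₁  = s≤s (≤-trans (≤-reflexive (sym (exactly few₂ 3≤n₂))) (m≤n+m a₂ a₁))
    where
    3≤n₂ : 3 ≤ n₂
    3≤n₂ = +-cancelˡ-≤ 2 3 n₂ (≤-trans le (+-monoˡ-≤ n₂ (≤-pred (≰⇒> 3≰n₁))))

range-∷ʳ : ∀ {p k} n → p ↭ range k n → n + k ∷ p ↭ range k (suc n)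
range-∷ʳ {k = k} n cover =
  ↭-trans (prep (n + k) (↭-trans cover (↭-sym (countdown-↭ k n)))) (countdown-↭ k (suc n))

-- The column order has four ones; the turn repeats its last step, which makes four or five.
sparseTurn : ∀ {y c m β α e a₁ b₁ b₂} k r t → c ≡ k * y + (3 + r) → 4 + r + t ≡ y →
  flips above r ≡ above → flips below y ≡ above →
  Walk y y β m a₁ b₁ → β ↭ range (4 + r) t → b₁ + a₁ ≡ t →
  ∀ a₂ → Walk y m α e a₂ b₂ → α ↭ range 1 (3 + r) → a₂ + b₂ ≡ 3 + r → a₁ + a₂ ≡ 4 → Sparse y c
sparseTurn {y} {β = β} {e = v} {a₁} {b₁} k r t c≡ eq r-odd y-odd wβ coverβ totalβ _ w coverα totalα ones
  with unsnoc (≤-trans (s≤s z≤n) (≤-reflexive (sym (↭-range-length coverα)))) w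
... | unsnoced {q} {u} {a′} {b′} {i′} {j′} refl w₁ s₂ refl refl
    with len-q ← suc-injective (trans (sym (length-snoc q v)) (↭-range-length coverα))
    with unsnoc (≤-trans (s≤s z≤n) (≤-reflexive (sym len-q))) w₁
... | unsnoced {α} {x} {a″} {b″} {i} {j} refl w₂ s₁ refl refl =
  loose (≤-trans (m≤m+n 4 i′) (≤-reflexive four+))
    (≤-trans (≤-reflexive (sym four+)) (+-monoʳ-≤ 4 (≤-trans (m≤m+n i′ j′) (≤-reflexive one-step))))
    all path
  where
  length-α : length α ≡ 1 + r
  length-α = suc-injective (trans (sym (length-snoc α u)) len-q)
  le : 4 + r ≤ y
  le = ≤-trans (m≤m+n (4 + r) t) (≤-reflexive eq)
  coverα′ : α ++ u ∷ v ∷ [] ↭ range 1 (3 + r)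
  coverα′ = ↭-trans (↭-reflexive (sym (++-assoc α (u ∷ []) (v ∷ [])))) coverα
  small : All (_< y) (α ++ u ∷ v ∷ [])
  small = ↭-range-< coverα′ le
  path : Standard y (a₁ + (a″ + (i + (i′ + i′)))) (b₁ + (b″ + (j + (j′ + j′)))) (1 + (y + _))
  path = widen {d = 1} k (3 + r) c≡ refl
    (fromGrid k (m≤m+n y (4 + r))
      (layoutTurn wβ
        (alternating-range above coverβ (≤-reflexive eq)
          (flips-flip below t (flips-rest below (4 + r) t (flips-flip above r r-odd) (trans (cong (flips below) eq) y-odd))))
        coverβ w₂
        (subst (Run y below α) (trans (cong (flips below) length-α) r-odd) (alternating below (++⁻ˡ α small)))
        coverα′ eq s₁ s₂))
  -- All `3 + r` steps of `w` are counted, and those before the last make up at most `2 + r`, so the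
  -- last is counted too.
  one-step : i′ + j′ ≡ 1
  one-step = ≤-antisym (step≤1 s₂) (+-cancelˡ-≤ (2 + r) 1 (i′ + j′)
    (≤-trans (≤-reflexive (trans (+-comm (2 + r) 1) (trans (sym totalα) (exchange (a″ + i) i′ (b″ + j) j′))))
      (+-monoˡ-≤ (i′ + j′) (≤-trans (counted≤length w₁) (≤-reflexive len-q)))))
    where
    exchange : ∀ a i b j → a + i + (b + j) ≡ a + b + (i + j)
    exchange = solve-∀
  regroup : ∀ a₁ a i k → a₁ + (a + i + k) + k ≡ a₁ + (a + (i + (k + k)))
  regroup = solve-∀
  four+ : 4 + i′ ≡ a₁ + (a″ + (i + (i′ + i′)))
  four+ = trans (cong (_+ i′) (sym ones)) (regroup a₁ a″ i i′)
  all : a₁ + (a″ + (i + (i′ + i′))) + (b₁ + (b″ + (j + (j′ + j′)))) ≡ y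
  all = trans (cong₂ _+_ (sym (regroup a₁ a″ i i′)) (sym (regroup b₁ b″ j j′)))
    (trans (exchange a₁ (a″ + i + i′) i′ b₁ (b″ + j + j′) j′)
    (trans (cong₂ _+_ (cong₂ _+_ totalα totalβ) one-step) (trans (+-comm (3 + r + t) 1) eq)))
    where
    exchange : ∀ a₁ a k b₁ b l → a₁ + a + k + (b₁ + b + l) ≡ a + b + (b₁ + a₁) + (k + l)
    exchange = solve-∀

-- Columns of equal height are taken in one block, which keeps the ones few; straight steps in front
-- supply those that the bound on `b` still demands.
sparseStandard : ∀ y c → 7 ≤ y → Sparse y c
sparseStandard y c 7≤y with residue y c (≤-trans (s≤s z≤n) 7≤y)
sparseStandard y c 7≤y | zero k eq with n , refl ← m≤n⇒∃[o]m+o≡n 7≤y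
    with p , e , w , cover ← ascending y 3 (3 + n) mixed =
  tight ≤-refl (s≤s (s≤s (s≤s z≤n))) refl
    (subst (Standard y 3 (3 + n)) (trans (+-comm (k * y) y) (cong (y +_) (sym eq)))
      (fromGrid k ≤-refl (grid w (alternating-range below (prep 0 cover) ≤-refl refl) (prep 0 cover))))
sparseStandard y c 7≤y | one k eq with n , refl ← m≤n⇒∃[o]m+o≡n 7≤y
    with p , e , w , cover ← descending y 1 3 (3 + n) mixed (+-comm (6 + n) 1) =
  tight ≤-refl (s≤s (s≤s (s≤s z≤n))) refl
    (widen {d = 0} k 1 eq refl (fromGrid k (m≤m+n y 1) (layoutLeft₀ w cover refl)))
sparseStandard y c 7≤y | even k (suc r) t eq total r-even
    with a₁ , b₁ , block {p} {u} w₁ cover₁ exit₁ , few₁ ← ascendAny y r (inj₁ refl)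
    with a₂ , b₂ , block w₂ cover₂ _ , few₂ ← ascendAny y t (subst (u ↗_) (+-comm r 2) exit₁) =
  tight (fewOnes-≥ few₁ few₂ (+-cancelˡ-≤ 2 5 (r + t) (≤-trans 7≤y (≤-reflexive (sym total))))) (fewOnes-≤ few₁ few₂)
    (trans (fewOnes-total few₁ few₂) total)
    (widen {d = 0} k (2 + r) eq refl (fromGrid k (m≤m+n y (2 + r))
      (layoutRight (straight y 0 1 ▷ w₁)
        (alternating-range below (prep 0 (prep 1 cover₁)) (≤-trans (m≤m+n (2 + r) t) (≤-reflexive total)) r-even)
        (prep 0 (prep 1 cover₁)) w₂ (alternating-range below cover₂ (≤-reflexive total) refl) cover₂ total)))
sparseStandard y c 7≤y | oddEven k r zero eq total r-odd y-even
  with () ← flips-rest below (suc r) 0 r-odd (trans (cong (flips below) total) y-even)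
sparseStandard y c 7≤y | oddEven k r (suc t) eq total r-odd y-even
    with a₁ , b₁ , block {p} {u} w₁ cover₁ exit₁ , few₁ ← descendAny y (suc r) t (inj₁ refl)
    with a₂ , b₂ , block w₂ cover₂ _ , few₂ ← descendAny y 1 r (subst (u ↘_) (+-comm 1 r) exit₁) =
  tight (fewOnes-≥ few₁ few₂ (+-cancelˡ-≤ 2 5 (t + r) (≤-trans 7≤y (≤-reflexive (trans (sym total) (exchange r t))))))
    (fewOnes-≤ few₁ few₂)
    (trans (fewOnes-total few₁ few₂) (trans (sym (exchange r t)) total))
    (widen {d = 0} k (suc r) eq refl (fromGrid k (m≤m+n y (suc r))
      (layoutLeft
        (leftwards y (t + suc r) 1 (trans (sym (exchange′ r t)) total) ▷ w₁)
        (alternating-range above (range-∷ʳ t cover₁) (≤-reflexive total)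
          (flips-rest below (suc r) (suc t) r-odd (trans (cong (flips below) total) y-even)))
        (range-∷ʳ t cover₁) w₂
        (alternating-range below cover₂ (≤-trans (m≤m+n (suc r) (suc t)) (≤-reflexive total)) refl) cover₂ total)))
  where
  exchange : ∀ r t → suc r + suc t ≡ 2 + (t + r)
  exchange = solve-∀
  exchange′ : ∀ r t → suc r + suc t ≡ 1 + (t + suc r)
  exchange′ = solve-∀
sparseStandard y c 7≤y | oddOdd (odd k r 0 eq total r-odd y-odd)
  with () ← flips-rest below (4 + r) 0 (flips-flip above r r-odd) (trans (cong (flips below) total) y-odd)
-- A single column is too short for a block of two ones; two straight steps and one block give the
-- four.
sparseStandard y c 7≤y | oddOdd (odd k (suc r) 1 eq total r-odd y-odd)
    with block w cover _ ← descend y 1 r (inj₁ refl) =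
  sparseTurn k (suc r) 1 eq total r-odd y-odd
    (leftwards y (5 + r) 1 (trans (+-comm 1 (5 + r)) total)) refl refl 3
    (leftwards y (3 + r + 1) 1 (cong (4 +_) (+-comm r 1)) ▷ w) (range-∷ʳ (3 + r) cover) refl refl
sparseStandard y c 7≤y | oddOdd (odd k 0 1 eq total r-odd y-odd)
  with s≤s (s≤s (s≤s (s≤s (s≤s ())))) ← ≤-trans 7≤y (≤-reflexive (sym total))
sparseStandard y c 7≤y | oddOdd (odd k r 2 eq total r-odd y-odd)
  with () ← flips-rest below (4 + r) 2 (flips-flip above r r-odd) (trans (cong (flips below) total) y-odd)
sparseStandard y c 7≤y | oddOdd (odd k r (suc (suc (suc t))) eq total r-odd y-odd)
    with block {p} {u} w₁ cover₁ exit₁ ← descend y (4 + r) t (inj₁ (trans (sym total) (+-comm (4 + r) (3 + t))))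
    with block w₂ cover₂ _ ← descend y 1 r (subst (u ↘_) (+-comm 1 (3 + r)) exit₁) =
  sparseTurn k r (3 + t) eq total r-odd y-odd w₁ cover₁ (+-comm (suc t) 2) 2 w₂ cover₂ refl refl

manyThrees : ∀ y a b c → 0 < y → 7 ≤ a → y ≤ b + 4 → HasLinearRealization (a + b + c + 1) (L13y a b c y)
manyThrees y a b c 0<y 7≤a le with 7 ≤? y
-- Here `y + 1 ≤ 7 ≤ a`.
... | no 7≰y = manyOnes y a b c 0<y (≤-trans (≤-reflexive (+-comm y 1)) (≤-trans (≰⇒> 7≰y) 7≤a))
... | yes 7≤y with sparse {a′} {b′} a′≤5 b′+4≤y path ← sparseStandard y c 7≤y
    with d , refl ← m≤n⇒∃[o]m+o≡n (≤-trans (+-monoʳ-≤ 2 a′≤5) 7≤a)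
    with e , refl ← m≤n⇒∃[o]m+o≡n (+-cancelʳ-≤ 4 b′ b (≤-trans b′+4≤y le)) =
  finish c (linkable (m≤m+n 2 d)) path (rearrange a′ d) (+-comm e b′)
  where
  rearrange : ∀ a d → 2 + d + a ≡ 2 + a + d
  rearrange = solve-∀

-- Case (4)

cover-after-straight : ∀ {p w} d → 0 ∷ p ↭ range 0 w → 0 ∷ range 1 d ++ map (d +_) p ↭ range 0 (d + w)
cover-after-straight {p} {w} d cover =
  ↭-trans (↭-reflexive (trans (cong (_++ map (d +_) p) (trans (cong (range 0) (+-comm 1 d)) (range-+ 0 d 1)))
    (++-assoc (range 0 d) (d + 0 ∷ []) (map (d +_) p))))
  (↭-trans (++⁺ˡ (range 0 d) (map⁺ (d +_) cover))
  (↭-reflexive (trans (cong (range 0 d ++_) (map-range d 0 w)) (sym (range-+ 0 d w)))))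

prependOnes : ∀ {y a b w} d → Standard y a b w → Standard y (d + a) b (d + w)
prependOnes {y} {w = w} d (standard walk cover) =
  standard (straight y 0 d ▷ translate d walk) (cover-after-straight d cover)

mod3 : ∀ n → ∃[ q ] (n ≡ q * 3 ⊎ n ≡ 1 + q * 3 ⊎ n ≡ 2 + q * 3)
mod3 0 = 0 , inj₁ refl
mod3 1 = 0 , inj₂ (inj₁ refl)
mod3 2 = 0 , inj₂ (inj₂ refl)
mod3 (suc (suc (suc n))) with mod3 n
... | q , inj₁ eq        = suc q , inj₁ (cong (3 +_) eq)
... | q , inj₂ (inj₁ eq) = suc q , inj₂ (inj₁ (cong (3 +_) eq))
... | q , inj₂ (inj₂ eq) = suc q , inj₂ (inj₂ (cong (3 +_) eq))

-- On a residue class mod 3, the lengths 1 and t become 3 and 3t.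
class : ℕ → ℕ → ℕ
class i x = i + 3 * x

class-distance : ∀ i x z → ∣ class i x - class i z ∣ ≡ 3 * ∣ x - z ∣
class-distance i x z = trans (∣m+n-m+o∣≡∣n-o∣ i (3 * x) (3 * z)) (sym (*-distribˡ-∣-∣ 3 x z))

class-adjacent : ∀ i j x → ∣ class i x - class j x ∣ ≡ ∣ i - j ∣
class-adjacent i j x = trans (cong₂ ∣_-_∣ (+-comm i (3 * x)) (+-comm j (3 * x))) (∣m+n-m+o∣≡∣n-o∣ (3 * x) i j)

-- A step of length 3 would become one of length 9, whence `b ≡ 0`.
class-walk : ∀ {t x p e a b} i → b ≡ 0 → Walk t x p e a b →
  Walk (3 * t) (class i x) (map (class i) p) (class i e) 0 a
class-walk i _ stop = stop
class-walk i eq₀ (step {x} {z} (one eq) w) =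
  step (three (trans (class-distance i x z) (cong (3 *_) eq))) (class-walk i eq₀ w)
class-walk i () (step (three _) w)
class-walk i eq₀ (step {x} {z} (big eq) w) =
  step (big (trans (class-distance i x z) (cong (3 *_) eq))) (class-walk i eq₀ w)

classes : ℕ → ℕ → ℕ → ℕ → List ℕ
classes k n₀ n₁ n₂ = map (class 0) (range k n₀) ++ map (class 1) (range k n₁) ++ map (class 2) (range k n₂)

data Balanced : ℕ → ℕ → ℕ → ℕ → Set where
  none     : Balanced 0 0 0 0
  first    : Balanced 1 0 0 1
  firstTwo : Balanced 1 1 0 2
  row      : ∀ {n₀ n₁ n₂ n} → Balanced n₀ n₁ n₂ n → Balanced (suc n₀) (suc n₁) (suc n₂) (3 + n)

rows : ∀ {n₀ n₁ n₂ d} n → Balanced n₀ n₁ n₂ d → Balanced (n + n₀) (n + n₁) (n + n₂) (n * 3 + d)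
rows zero    base = base
rows (suc n) base = row (rows n base)

classes-↭ : ∀ {n₀ n₁ n₂ n} → Balanced n₀ n₁ n₂ n → ∀ k → classes k n₀ n₁ n₂ ↭ range (3 * k) n
classes-↭ none     k = refl
classes-↭ first    k = refl
classes-↭ firstTwo k = refl
classes-↭ (row {n₀} {n₁} {n₂} {n} balanced) k =
  prep _ (↭-trans (shifts R₀ (class 1 k ∷ [])) (prep _ (↭-trans (++⁺ˡ R₀ (shift (class 2 k) R₁ R₂))
    (↭-trans (shift (class 2 k) R₀ (R₁ ++ R₂)) (prep _ rest)))))
  where
  R₀ = map (class 0) (range (suc k) n₀)
  R₁ = map (class 1) (range (suc k) n₁)
  R₂ = map (class 2) (range (suc k) n₂)
  rest : classes (suc k) n₀ n₁ n₂ ↭ range (3 + 3 * k) n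
  rest = subst (λ i → classes (suc k) n₀ n₁ n₂ ↭ range i n) (*-suc 3 k) (classes-↭ balanced (suc k))

braid : ∀ {t x₀ p₀ e₀ b₀ x₁ p₁ e₁ b₁ x₂ p₂ e₂ b₂} i₀ i₁ i₂ n₀ n₁ n₂ →
  Walk t x₀ p₀ e₀ b₀ 0 → x₀ ∷ p₀ ↭ range 0 n₀ →
  Walk t x₁ p₁ e₁ b₁ 0 → x₁ ∷ p₁ ↭ range 0 n₁ →
  Walk t x₂ p₂ e₂ b₂ 0 → x₂ ∷ p₂ ↭ range 0 n₂ →
  ∣ class i₀ e₀ - class i₁ x₁ ∣ ≡ 1 → ∣ class i₁ e₁ - class i₂ x₂ ∣ ≡ 1 →
  ∃[ p ] (Walk (3 * t) (class i₀ x₀) p (class i₂ e₂) 2 (b₀ + (b₁ + b₂)) ×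
    class i₀ x₀ ∷ p ↭ map (class i₀) (range 0 n₀) ++ map (class i₁) (range 0 n₁) ++ map (class i₂) (range 0 n₂))
braid i₀ i₁ i₂ n₀ n₁ n₂ w₀ cover₀ w₁ cover₁ w₂ cover₂ link₁ link₂ =
  _ ,
  class-walk i₀ refl w₀ ▷ step (one link₁) (class-walk i₁ refl w₁ ▷ step (one link₂) (class-walk i₂ refl w₂)) ,
  ++⁺ (map⁺ (class i₀) cover₀) (++⁺ (map⁺ (class i₁) cover₁) (map⁺ (class i₂) cover₂))

-- The first path and its reverse meet at the same `e` in adjacent classes, and the reverse ends at
-- `0`, where the third path starts. So nothing about `e` has to be known.
folded : ∀ {t b b′ n n′} i₀ i₁ i₂ → ∣ i₀ - i₁ ∣ ≡ 1 → ∣ i₁ - i₂ ∣ ≡ 1 → Standard t b 0 n → Standard t b′ 0 n′ →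
  ∃[ p ] ∃[ e ] (Walk (3 * t) (class i₀ 0) p e 2 (b + (b + b′)) ×
    class i₀ 0 ∷ p ↭ map (class i₀) (range 0 n) ++ map (class i₁) (range 0 n) ++ map (class i₂) (range 0 n′))
folded {n = n} {n′} i₀ i₁ i₂ eq₁ eq₂ (standard {exit = e} w cover) (standard w′ cover′)
  with q , w⁻ , cover⁻ ← reverseWalk w
  with p , walk , covers ← braid i₀ i₁ i₂ n n n′ w cover w⁻ (↭-trans cover⁻ cover) w′ cover′
    (trans (class-adjacent i₀ i₁ e) eq₁) (trans (class-adjacent i₁ i₂ 0) eq₂) =
  p , _ , walk , covers

foldEqual : ∀ {t b b′ n} → Standard t b 0 n → Standard t b′ 0 n → Standard (3 * t) 2 (b + (b + b′)) (n * 3)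
foldEqual {n = n} P Q with p , e , walk , cover ← folded 0 1 2 refl refl P Q =
  standard walk (↭-trans cover
    (subst₂ (λ i j → classes 0 i i i ↭ range 0 j) (+-identityʳ n) (+-identityʳ (n * 3)) (classes-↭ (rows n none) 0)))

foldUnequal : ∀ {t b b′ n} → Standard t b 0 (suc n) → Standard t b′ 0 n → Standard (3 * t) 2 (b + (b + b′)) (2 + n * 3)
foldUnequal {n = n} P Q with p , e , walk , cover ← folded 0 1 2 refl refl P Q =
  standard walk (↭-trans cover (subst₂ _↭_
    (cong₂ (λ i j → classes 0 i i j) (+-comm n 1) (+-identityʳ n)) (cong (range 0) (+-comm (n * 3) 2))
    (classes-↭ (rows n firstTwo) 0)))

-- Vertex `0` precedes a translate by 1; with the classes in the order 2, 1, 0 this translate starts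
-- at `3`, so the extra step is a three.
foldShifted : ∀ {t b b′ n} → Standard t b 0 n → Standard t b′ 0 n → Standard (3 * t) 2 (suc (b + (b + b′))) (1 + n * 3)
foldShifted {n = n} P Q with p , e , walk , cover ← folded 2 1 0 refl refl P Q =
  standard (step (three refl) (translate 1 walk))
    (prep 0 (↭-trans (map⁺ suc (↭-trans cover reorder)) (↭-reflexive (map-range 1 0 (n * 3)))))
  where
  C : ℕ → List ℕ
  C i = map (class i) (range 0 n)
  reorder : C 2 ++ C 1 ++ C 0 ↭ range 0 (n * 3)
  reorder = ↭-trans
    (solve 3 (λ a b c → c ⊕ b ⊕ a ⊜ a ⊕ b ⊕ c) ↭-refl (C 0) (C 1) (C 2))
    (subst₂ (λ i j → classes 0 i i i ↭ range 0 j) (+-identityʳ n) (+-identityʳ (n * 3)) (classes-↭ (rows n none) 0))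

-- A straight order takes `t - 1` ones, a turn takes `t`; surplus ones go in front.
enoughOnes : ∀ {t b} c → 0 < t → t ≤ b → Standard t b 0 (suc (b + c))
enoughOnes {suc m} {b} c _ t≤b with d , refl ← m≤n⇒∃[o]m+o≡n t≤b with straightStandard m c
... | inj₁ path = subst₂ (λ i j → Standard (suc m) i 0 j) (rearrange m d) (rearrange′ m d c) (prependOnes (suc d) path)
  where
  rearrange : ∀ m d → suc d + m ≡ suc m + d
  rearrange = solve-∀
  rearrange′ : ∀ m d c → suc d + (suc m + c) ≡ suc (suc m + d + c)
  rearrange′ = solve-∀
... | inj₂ o =
  subst₂ (λ i j → Standard (suc m) i 0 j) (+-comm d (suc m)) (rearrange m d c) (prependOnes d (proj₁ (turnStandard m c o)))
  where
  rearrange : ∀ m d c → d + (1 + (suc m + c)) ≡ suc (suc m + d + c)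
  rearrange = solve-∀

-- The path `0, t, t - 1, …, 1` has one step of length 1 fewer than `enoughOnes` asks for.
oneJump : ∀ {t b} → t ≡ suc b → Standard t b 0 (2 + b)
oneJump {b = b} refl =
  subst (Standard (suc b) b 0) (+-comm (suc b) 1)
    (fromGrid 0 (m≤m+n (suc b) 1) (layoutLeft₀ (leftwards (suc b) 1 b (+-comm b 1)) (countdown-↭ 1 b) refl))

-- Two paths on residue classes for the path P, reversed P, Q through the three classes.
record Folding (t b c : ℕ) : Set where
  constructor folding
  field
    {b₁ b₂ n} : ℕ
    outer     : Standard t b₁ 0 n
    inner     : Standard t b₂ 0 n
    threes    : b₁ + (b₁ + b₂) ≡ b
    size      : n * 3 ≡ 3 + b + c

-- The subscripts are the residues of b and c mod 3.
folding₀₀ : ∀ {t} β γ → 0 < t → t ≤ β → Folding t (β * 3) (γ * 3)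
folding₀₀ β γ 0<t t≤β = folding (enoughOnes γ 0<t t≤β) (enoughOnes γ 0<t t≤β) (rearrange β) (rearrange′ β γ)
  where
  rearrange : ∀ β → β + (β + β) ≡ β * 3
  rearrange = solve-∀
  rearrange′ : ∀ β γ → suc (β + γ) * 3 ≡ 3 + β * 3 + γ * 3
  rearrange′ = solve-∀

folding₁₂ : ∀ {t} β γ → 0 < t → t ≤ β → Folding t (1 + β * 3) (2 + γ * 3)
folding₁₂ β γ 0<t t≤β =
  folding (enoughOnes (suc γ) 0<t t≤β)
    (subst (Standard _ (suc β) 0) (cong suc (sym (+-suc β γ))) (enoughOnes γ 0<t (m≤n⇒m≤1+n t≤β)))
    (rearrange β) (rearrange′ β γ)
  where
  rearrange : ∀ β → β + (β + suc β) ≡ 1 + β * 3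
  rearrange = solve-∀
  rearrange′ : ∀ β γ → suc (β + suc γ) * 3 ≡ 3 + (1 + β * 3) + (2 + γ * 3)
  rearrange′ = solve-∀

folding₂₁ : ∀ {t} β γ → 0 < t → t ≤ β → Folding t (2 + β * 3) (1 + γ * 3)
folding₂₁ β γ 0<t t≤β =
  folding (subst (Standard _ (suc β) 0) (cong suc (sym (+-suc β γ))) (enoughOnes γ 0<t (m≤n⇒m≤1+n t≤β)))
    (enoughOnes (suc γ) 0<t t≤β)
    (rearrange β) (rearrange′ β γ)
  where
  rearrange : ∀ β → suc β + (suc β + β) ≡ 2 + β * 3
  rearrange = solve-∀
  rearrange′ : ∀ β γ → suc (β + suc γ) * 3 ≡ 3 + (2 + β * 3) + (1 + γ * 3)
  rearrange′ = solve-∀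

foldToStandard : ∀ {t b c} → Folding t b c → Standard (3 * t) 2 b (3 + b + c)
foldToStandard (folding P Q refl size) = subst (Standard _ 2 _) size (foldEqual P Q)

foldToShifted : ∀ {t b c} → Folding t b c → Standard (3 * t) 2 (suc b) (3 + suc b + c)
foldToShifted (folding P Q refl size) = subst (Standard _ 2 _) (cong suc size) (foldShifted P Q)

module _ {t} (β γ : ℕ) (0<t : 0 < t) where

  unequal₀₂ : t ≤ β → Standard (3 * t) 2 (β * 3) (3 + β * 3 + (2 + γ * 3))
  unequal₀₂ t≤β = subst₂ (Standard (3 * t) 2) (rearrange β) (rearrange′ β γ)
    (foldUnequal (subst (Standard t β 0) (cong suc (+-suc β γ)) (enoughOnes (suc γ) 0<t t≤β)) (enoughOnes γ 0<t t≤β))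
    where
    rearrange : ∀ β → β + (β + β) ≡ β * 3
    rearrange = solve-∀
    rearrange′ : ∀ β γ → 2 + suc (β + γ) * 3 ≡ 3 + β * 3 + (2 + γ * 3)
    rearrange′ = solve-∀

  unequal₂₀ : t ≤ β → Standard (3 * t) 2 (2 + β * 3) (3 + (2 + β * 3) + γ * 3)
  unequal₂₀ t≤β = subst₂ (Standard (3 * t) 2) (rearrange β) (rearrange′ β γ)
    (foldUnequal (enoughOnes γ 0<t (m≤n⇒m≤1+n t≤β)) (enoughOnes γ 0<t t≤β))
    where
    rearrange : ∀ β → suc β + (suc β + β) ≡ 2 + β * 3
    rearrange = solve-∀
    rearrange′ : ∀ β γ → 2 + suc (β + γ) * 3 ≡ 3 + (2 + β * 3) + γ * 3
    rearrange′ = solve-∀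

unequal₁₁ : ∀ {t} β γ → 0 < t → t ≤ β → Standard (3 * t) 2 (1 + β * 3) (3 + (1 + β * 3) + (1 + γ * 3))
unequal₁₁ {t} β (suc γ) 0<t t≤β = subst₂ (Standard (3 * t) 2) (rearrange β) (rearrange′ β γ)
  (foldUnequal
    (subst (Standard t β 0) (cong suc (trans (+-suc β (suc γ)) (cong suc (+-suc β γ)))) (enoughOnes (2 + γ) 0<t t≤β))
    (enoughOnes γ 0<t (m≤n⇒m≤1+n t≤β)))
  where
  rearrange : ∀ β → β + (β + suc β) ≡ 1 + β * 3
  rearrange = solve-∀
  rearrange′ : ∀ β γ → 2 + suc (suc β + γ) * 3 ≡ 3 + (1 + β * 3) + (1 + suc γ * 3)
  rearrange′ = solve-∀
unequal₁₁ {t} zero zero 0<t t≤β with () ← ≤-trans 0<t t≤β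
-- With `c = 1` the only long step goes to the third path, which is left with `β` ones although only
-- `t ≤ suc β` is known.
unequal₁₁ {t} (suc β) zero 0<t t≤β = subst₂ (Standard (3 * t) 2) (rearrange β) (rearrange′ β)
  (foldUnequal (subst (Standard t (2 + β) 0) (cong suc (+-identityʳ (2 + β))) (enoughOnes 0 0<t (m≤n⇒m≤1+n t≤β)))
    (inner (m≤n⇒m<n∨m≡n t≤β)))
  where
  inner : t < suc β ⊎ t ≡ suc β → Standard t β 0 (2 + β)
  inner (inj₁ (s≤s t≤β)) = subst (Standard t β 0) (cong suc (+-comm β 1)) (enoughOnes 1 0<t t≤β)
  inner (inj₂ eq)        = oneJump eq
  rearrange : ∀ β → 2 + β + (2 + β + β) ≡ 1 + suc β * 3
  rearrange = solve-∀
  rearrange′ : ∀ β → 2 + (2 + β) * 3 ≡ 3 + (1 + suc β * 3) + 1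
  rearrange′ = solve-∀

-- Exactly `3t` steps of length 3

Span : (y x e a n : ℕ) → Set
Span y x e a n = ∃[ p ] (Walk y x p e a 0 × x ∷ p ↭ range 0 n)

span : ∀ {y s σ e τ a w} k → y ≤ w → Grid y s σ e τ a 0 w → Span y (raise y σ k s) (raise y τ k e) a (k * y + w)
span {y} {w = w} k y≤w g with grid {p} walk _ cover ← growGrids k y≤w g =
  p , walk , subst (λ i → _ ↭ range 0 i) (raise-above y k w) cover

respan : ∀ {y x x′ e e′ a n} → x ≡ x′ → e ≡ e′ → Span y x e a n → Span y x′ e′ a n
respan refl refl p = p

afterTwo : ∀ {y e a n} → Span y 0 e a n → Span y 0 (2 + e) (2 + a) (2 + n)
afterTwo {y} (p , walk , cover) = _ , straight y 0 2 ▷ translate 2 walk , cover-after-straight 2 cover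

-- Columns are taken from the last to the first with the turn at columns `1` and `0`, so the path
-- can start at the bottom of column `y - 1`.
lastColumn : ∀ {y} r t → 4 + r + t ≡ y → flips above r ≡ above → flips above t ≡ below →
  Grid y (t + (3 + r)) below 1 above y 0 (y + (3 + r))
lastColumn {y} r t refl r-odd t-odd = grid
  (recount (rearrange t r) refl (straightDown y (3 + r) t ▷ grow-walk rα (leftwards y 2 (1 + r) (+-comm (1 + r) 2)) ▷
    turn-walk (one refl) (one refl)))
  (alternating-range below (countdown-↭ (3 + r) (1 + t)) (≤-reflexive total) t-odd ⋈ grow-run rα ⋈
    turn-run (s≤s (s≤s z≤n) ∷ s≤s z≤n ∷ []))
  (↭-trans (++-comm (countdown (3 + r) (1 + t)) _)
    (cover-double coverα (countdown-↭ (3 + r) (1 + t)) total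
      (turn-↭ rα (↭-range-< coverα (≤-trans (m≤m+n (3 + r) (1 + t)) (≤-reflexive total))))))
  where
  total : 3 + r + (1 + t) ≡ 4 + r + t
  total = +-suc (3 + r) t
  rα : Run y below (countdown 2 (1 + r)) above
  rα = alternating-range below (countdown-↭ 2 (1 + r)) (≤-trans (m≤m+n (3 + r) (1 + t)) (≤-reflexive total)) r-odd
  coverα : countdown 2 (1 + r) ++ 1 ∷ 0 ∷ [] ↭ range 0 (3 + r)
  coverα = ↭-trans (++-comm (countdown 2 (1 + r)) (1 ∷ 0 ∷ [])) (swap 1 0 (countdown-↭ 2 (1 + r)))
  rearrange : ∀ t r → t + (1 + r + (1 + (1 + 1))) ≡ 4 + r + t
  rearrange = solve-∀

-- With as few as 3y steps of length 1, a path and its reverse cannot be used as in foldShifted.  Instead,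
-- three paths on N + 1, N and N vertices have matching ends, where N = k * y + (y + (3 + r)).
module _ (k r t : ℕ) (r-odd : flips above r ≡ above) (y-odd : flips below (4 + r + t) ≡ above) where
  private
    y = 4 + r + t

    r-even : flips below r ≡ below
    r-even = flips-flip above r r-odd

    t-odd : flips below t ≡ above
    t-odd = flips-rest below (4 + r) t r-even y-odd

  upwards : Span y 0 (2 + (k * y + (2 + t + (1 + r + 0)))) (2 + (1 + r + (2 + t))) (2 + (k * y + (y + (2 + r))))
  upwards = afterTwo (respan (raise-below y k 0)
    (trans (cong (λ σ → raise y σ k (2 + t + (1 + r + 0))) t-odd) (raise-above y k _))
    (span k (m≤m+n y (2 + r))
      (straightRight {y} below (1 + r) (2 + t) (trans (+-suc (2 + r) (1 + t)) (+-suc (3 + r) t)) r-even)))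

  downwards : Span y (k * y + (y + 0)) (1 + t + (2 + r + 0)) (2 + r + (1 + t)) (k * y + (y + (3 + r)))
  downwards = respan (raise-above y k (y + 0))
    (trans (cong (λ σ → raise y σ k (1 + t + (2 + r + 0))) (flips-flip below t t-odd)) (raise-below y k _))
    (span k (m≤m+n y (3 + r)) (straightRight {y} above (2 + r) (1 + t) (+-suc (3 + r) t) r-even))

  turning : Span y (t + (3 + r)) (raise y above k 1) y (k * y + (y + (3 + r)))
  turning = respan (raise-below y k _) refl
    (span k (m≤m+n y (3 + r)) (lastColumn {y} r t refl r-odd (flips-flip below t t-odd)))

upwards-downwards : ∀ K r t → 3 * (2 + (K + (2 + t + (1 + r + 0)))) ≡ 1 + (2 + 3 * (K + (4 + r + t + 0)))
upwards-downwards = solve-∀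

downwards-turning : ∀ r t → 2 + 3 * (1 + t + (2 + r + 0)) ≡ 1 + (1 + 3 * (t + (3 + r)))
downwards-turning = solve-∀

oddBraid : ∀ {y γ} → Odd y (suc γ) → Standard (3 * y) 3 (3 * y) (suc (3 + 3 * y + (1 + γ * 3)))
oddBraid {γ = γ} (odd k r t c≡ refl r-odd y-odd)
  with p₀ , w₀ , cover₀ ← upwards k r t r-odd y-odd
  with p₁ , w₁ , cover₁ ← downwards k r t r-odd y-odd
  with p₂ , w₂ , cover₂ ← turning k r t r-odd y-odd
  -- In the class order 0, 2, 1, `3(x + 1)` is next to `3x + 2`, and `3x + 2` to `3x + 1`. So
  -- `upwards` ends one beyond the start of `downwards`, and `turning` starts where `downwards`
  -- ends.
  with p , walk , cover ← braid 0 2 1 _ _ _ w₀ cover₀ w₁ cover₁ w₂ cover₂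
    (distance′ 1 (upwards-downwards (k * (4 + r + t)) r t)) (distance′ 1 (downwards-turning r t)) =
  subst₂ (Standard _ 3) (threes r t) size
    (prependOnes 1 (standard walk (↭-trans cover (↭-trans
      (solve 3 (λ a b c → a ⊕ c ⊕ b ⊜ a ⊕ b ⊕ c) ↭-refl
        (map (class 0) (range 0 (2 + (K + (y + (2 + r)))))) (map (class 1) (range 0 n)) (map (class 2) (range 0 n)))
      (subst (λ l → l ↭ range 0 (n * 3 + 1)) lengths (classes-↭ (rows n first) 0))))))
  where
  y = 4 + r + t
  K = k * y
  n = K + (y + (3 + r))
  threes : ∀ r t → 2 + (1 + r + (2 + t)) + (2 + r + (1 + t) + (4 + r + t)) ≡ 3 * (4 + r + t)
  threes = solve-∀
  size : 1 + (n * 3 + 1) ≡ suc (3 + 3 * y + (1 + γ * 3))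
  size = trans (cong (1 +_) (+-comm (n * 3) 1)) (trans (rearrange K r t)
    (trans (cong (λ i → 2 + i * 3 + 3 * y) (sym c≡)) (rearrange′ γ y)))
    where
    rearrange : ∀ K r t → 2 + (K + (4 + r + t + (3 + r))) * 3 ≡ 2 + (K + (3 + r)) * 3 + 3 * (4 + r + t)
    rearrange = solve-∀
    rearrange′ : ∀ γ y → 2 + (1 + γ) * 3 + 3 * y ≡ suc (3 + 3 * y + (1 + γ * 3))
    rearrange′ = solve-∀
  lengths : classes 0 (n + 1) (n + 0) (n + 0) ≡ classes 0 (2 + (K + (y + (2 + r)))) n n
  lengths = cong₂ (λ i j → classes 0 i j j) (rearrange K y r) (+-identityʳ n)
    where
    rearrange : ∀ K y r → K + (y + (3 + r)) + 1 ≡ 2 + (K + (y + (2 + r)))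
    rearrange = solve-∀

-- The extra step of `foldShifted` uses up a three, leaving `t - 1` for one class. A straight order
-- manages with these except in the case `Odd`.
exactThrees : ∀ t γ → 0 < t → Standard (3 * t) 3 (3 * t) (suc (3 + 3 * t + (1 + γ * 3)))
exactThrees t@(suc m) γ 0<t with straightStandard m (suc γ)
... | inj₂ o = oddBraid o
... | inj₁ path = subst₂ (Standard (3 * t) 3) (threes m) (size m γ)
  (prependOnes 1 (foldShifted (enoughOnes γ 0<t ≤-refl) (subst (Standard t m 0) (cong suc (+-suc m γ)) path)))
  where
  threes : ∀ m → suc (suc m + (suc m + m)) ≡ 3 * suc m
  threes = solve-∀
  size : ∀ m γ → 1 + (1 + suc (suc m + γ) * 3) ≡ suc (3 + 3 * suc m + (1 + γ * 3))
  size = solve-∀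

-- Two ones join the classes and the others go in front. Then `b + c` mod 3 decides: 0 gives equal
-- classes, 2 unequal ones, 1 the shifted path.
multipleOfThree : ∀ t a b c → 0 < t → 2 ≤ a →
  (((a + b + c + 1) % 3 ≡ 0 ⊎ (a + b + c + 1) % 3 ≡ 2) × 3 * t ≤ b) ⊎ ((a + b + c + 1) % 3 ≡ 1 × 3 * t + 1 ≤ b) →
  HasLinearRealization (a + b + c + 1) (L13y a b c (3 * t))
multipleOfThree t (suc (suc a)) b c 0<t (s≤s (s≤s _)) bound = cases (mod3 b) (mod3 c)
  where
  3t≤b : 3 * t ≤ b
  3t≤b = [ proj₂ , (λ bound → ≤-trans (m≤m+n (3 * t) 1) (proj₂ bound)) ]′ bound

  quotient≥ : ∀ {ρ β} → ρ < 3 → 3 * t ≤ ρ + β * 3 → t ≤ β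
  quotient≥ {ρ} {β} ρ<3 le = ≤-pred (*-cancelʳ-< 3 t (suc β)
    (≤-trans (s≤s (≤-trans (≤-reflexive (*-comm t 3)) le)) (+-monoˡ-≤ (β * 3) ρ<3)))

  two : Standard (3 * t) 2 b (3 + b + c) → HasLinearRealization (2 + a + b + c + 1) (L13y (2 + a) b c (3 * t))
  two path = finish c onesOnly path (+-comm a 2) refl

  cases : ∃[ β ] (b ≡ β * 3 ⊎ b ≡ 1 + β * 3 ⊎ b ≡ 2 + β * 3) → ∃[ γ ] (c ≡ γ * 3 ⊎ c ≡ 1 + γ * 3 ⊎ c ≡ 2 + γ * 3) →
    HasLinearRealization (2 + a + b + c + 1) (L13y (2 + a) b c (3 * t))
  cases (β , inj₁ refl) (γ , inj₁ refl) = two (foldToStandard (folding₀₀ β γ 0<t (quotient≥ {0} (s≤s z≤n) 3t≤b)))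
  cases (β , inj₂ (inj₁ refl)) (γ , inj₂ (inj₂ refl)) =
    two (foldToStandard (folding₁₂ β γ 0<t (quotient≥ {1} (s≤s (s≤s z≤n)) 3t≤b)))
  cases (β , inj₂ (inj₂ refl)) (γ , inj₂ (inj₁ refl)) =
    two (foldToStandard (folding₂₁ β γ 0<t (quotient≥ {2} ≤-refl 3t≤b)))
  cases (β , inj₁ refl) (γ , inj₂ (inj₂ refl)) = two (unequal₀₂ β γ 0<t (quotient≥ {0} (s≤s z≤n) 3t≤b))
  cases (β , inj₂ (inj₁ refl)) (γ , inj₂ (inj₁ refl)) =
    two (unequal₁₁ β γ 0<t (quotient≥ {1} (s≤s (s≤s z≤n)) 3t≤b))
  cases (β , inj₂ (inj₂ refl)) (γ , inj₁ refl) = two (unequal₂₀ β γ 0<t (quotient≥ {2} ≤-refl 3t≤b))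
  cases (β , inj₂ (inj₁ refl)) (γ , inj₁ refl) =
    two (foldToShifted (folding₀₀ β γ 0<t (quotient≥ {1} (s≤s (s≤s z≤n)) 3t≤b)))
  cases (β , inj₂ (inj₂ refl)) (γ , inj₂ (inj₂ refl)) =
    two (foldToShifted (folding₁₂ β γ 0<t (quotient≥ {2} ≤-refl 3t≤b)))
  -- The shifted path leaves `b - 1 = 2 + 3(β - 1)` threes for the classes, so `t < β` is required;
  -- for `b = 3t` a third one helps.
  cases (β , inj₁ refl) (γ , inj₂ (inj₁ refl)) with m≤n⇒m<n∨m≡n (quotient≥ {0} {β} (s≤s z≤n) 3t≤b)
  ... | inj₁ t<β with d , refl ← m≤n⇒∃[o]m+o≡n t<β = two (foldToShifted (folding₂₁ (t + d) γ 0<t (m≤m+n t d)))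
  ... | inj₂ refl = extra a bound
    where
    extra : ∀ a → (((2 + a + t * 3 + (1 + γ * 3) + 1) % 3 ≡ 0 ⊎ (2 + a + t * 3 + (1 + γ * 3) + 1) % 3 ≡ 2) × 3 * t ≤ t * 3) ⊎
      ((2 + a + t * 3 + (1 + γ * 3) + 1) % 3 ≡ 1 × 3 * t + 1 ≤ t * 3) →
      HasLinearRealization (2 + a + t * 3 + (1 + γ * 3) + 1) (L13y (2 + a) (t * 3) (1 + γ * 3) (3 * t))
    extra (suc a) _ =
      finish {b₁ = 0} (1 + γ * 3) onesOnly
        (subst (λ i → Standard (3 * t) 3 i (suc (3 + i + (1 + γ * 3)))) (*-comm 3 t) (exactThrees t γ 0<t))
        (+-comm a 3) refl
    -- With `a = 2` the number of vertices is 1 mod 3, and there `b ≥ 3t + 1` is assumed.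
    extra zero (inj₂ (_ , le)) =
      ⊥-elim (m+1+n≰m (3 * t) (≤-trans le (≤-reflexive (*-comm t 3))))
    extra zero (inj₁ (residue , _)) = ⊥-elim (notOne residue)
      where
      rearrange : ∀ t γ → 2 + 0 + t * 3 + (1 + γ * 3) + 1 ≡ 1 + (1 + t + γ) * 3
      rearrange = solve-∀
      isOne : (2 + 0 + t * 3 + (1 + γ * 3) + 1) % 3 ≡ 1
      isOne = trans (cong (_% 3) (rearrange t γ)) ([m+kn]%n≡m%n 1 (1 + t + γ) 3)
      notOne : (2 + 0 + t * 3 + (1 + γ * 3) + 1) % 3 ≡ 0 ⊎ (2 + 0 + t * 3 + (1 + γ * 3) + 1) % 3 ≡ 2 → ⊥
      notOne (inj₁ eq) with () ← trans (sym eq) isOne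
      notOne (inj₂ eq) with () ← trans (sym eq) isOne

theorem5p1 : (y a b c : ℕ) → 3 < y →
    Admissible (a + b + c + 1) (L13y a b c y) →
    ((y + 1 ≤ a)
    ⊎ (7 ≤ a × y ≤ b + 4)
    ⊎ (4 ≤ a × y + 1 ≤ a + b × Σ ℕ (λ k → c ≡ k * y ⊎ c ≡ k * y + 1))
    ⊎ (2 ≤ a × Σ ℕ (λ t → y ≡ 3 * t × 3 * t + 6 ≤ a + b + c + 1 ×
    ((((a + b + c + 1) % 3 ≡ 0 ⊎ (a + b + c + 1) % 3 ≡ 2) × 3 * t ≤ b)
    ⊎ ((a + b + c + 1) % 3 ≡ 1 × 3 * t + 1 ≤ b))))) →
    HasLinearRealization (a + b + c + 1) (L13y a b c y)
theorem5p1 y a b c 3<y _ (inj₁ le) = manyOnes y a b c (m<n⇒0<n 3<y) le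
theorem5p1 y a b c 3<y _ (inj₂ (inj₁ (7≤a , le))) = manyThrees y a b c (m<n⇒0<n 3<y) 7≤a le
theorem5p1 y a b c 3<y _ (inj₂ (inj₂ (inj₁ (4≤a , le , residue)))) = nearMultiple y a b c 3<y 4≤a le residue
theorem5p1 _ a b c 3<y _ (inj₂ (inj₂ (inj₂ (2≤a , suc t , refl , _ , bound)))) =
  multipleOfThree (suc t) a b c (s≤s z≤n) 2≤a bound
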